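{- Let $\lambda\vdash n$, let $M^\lambda$ be the $\mathfrak{S}_n$-permutation module with basis $\mathcal{B}$ the set of tabloids of shape $\lambda$, and let $\le$ be any total order on $\mathcal{B}$ extending the partial order $\vartriangleleft$ on tabloids. Then $(M^\lambda,\mathcal{B},\le)$ is strongly quasisymmetric characteristic compatible.
   Context: Tabloids of shape $\lambda$: row-equivalence classes of fillings of the (French-notation, bottom row longest) Young diagram of $\lambda$ by $1,\dots,n$; $s_i$ acts by swapping letters $i,i+1$. For tabloids $\{s\}\neq\{t\}$, $\{s\}\vartriangleleft\{t\}$ means the smallest letter lying in different rows of $\{s\}$ and $\{t\}$ lies in a higher row in $\{t\}$ than in $\{s\}$. Strong quasisymmetric characteristic compatibility (SQCC): let $M$ be a finite-dimensional $\mathfrak{S}_n$-module with basis $\mathcal{B}=\{v_1,\dots,v_k\}$ totally ordered $v_1\le\cdots\le v_k$. For $w=\sum c_jv_j\neq0$, its trailing term $\mathrm{tt}(w)$ is $c_jv_j$ for the $\le$-smallest $v_j$ with $c_j\neq0$. Define $\overline{\pi}_i$ on $\mathcal{B}$ (extended linearly) by: $\overline{\pi}_i(v_t)=0$ if $\mathrm{tt}(s_iv_t)=v_t$; $\overline{\pi}_i(v_t)=-v_t$ if $s_iv_t=v_j$ for some $v_j>v_t$ or $s_iv_t=-v_t$; $\overline{\pi}_i(v_t)=s_iv_t$ if $s_iv_t=v_j$ for some $v_j<v_t$ — assuming every basis element falls in one of these cases. If these $\overline{\pi}_i$ define an $\mathcal{H}_n(0)$-action (i.e., satisfy $\overline{\pi}_i^2=-\overline{\pi}_i$,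 $\overline{\pi}_i\overline{\pi}_j=\overline{\pi}_j\overline{\pi}_i$ for $|i-j|\ge2$, and $\overline{\pi}_i\overline{\pi}_{i+1}\overline{\pi}_i=\overline{\pi}_{i+1}\overline{\pi}_i\overline{\pi}_{i+1}$), call the resulting module $\widehat{M}$; $(M,\mathcal{B},\le)$ is SQCC if this holds and $F^Q_{char}(\widehat M)=F_{char}(M)$. Here, for $I\subseteq[n-1]$, $C_I$ is the one-dimensional $\mathcal{H}_n(0)$-module with $\overline{\pi}_i$ acting by $-1$ if $i\in I$, $0$ otherwise; $F^Q_{char}(N)=\sum_jF_{I_j}$ if $N$ has composition factors $C_{I_1},\dots,C_{I_m}$, with $F_I=\sum x_{i_1}\cdots x_{i_n}$ over $1\le i_1\le\cdots\le i_n$, $i_j<i_{j+1}$ for $j\in I$; $F_{char}$ is the Frobenius characteristic sending Specht modules $S^\mu$ to Schur functions $s_\mu$. -}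

module Defs where

open import Data.Bool using (Bool; true; false; if_then_else_; _∧_; _∨_; not)
open import Data.Nat as ℕ using (ℕ; zero; suc; _+_; _*_; _!; _<_; _≤_)
open import Data.Fin as Fin using (Fin; toℕ)
open import Data.Vec as Vec using (Vec; []; _∷_; lookup)
open import Data.List as List using (List; allFin; filter; length)
open import Data.Bool.ListAction using (all; any)
open import Data.Integer as ℤ using (ℤ; +_; -_)
open import Data.Product using (Σ; _×_; ∃)
open import Relation.Nullary.Decidable using (⌊_⌋)
open import Relation.Binary.PropositionalEquality using (_≡_)

eqℕ : ℕ → ℕ → Bool
eqℕ a b = ⌊ a ℕ.≟ b ⌋

eqFin : ∀ {m} → Fin m → Fin m → Bool
eqFin a b = ⌊ a Fin.≟ b ⌋

ltFin : ∀ {m} → Fin m → Fin m → Bool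
ltFin a b = ⌊ toℕ a ℕ.<? toℕ b ⌋

eqℤ : ℤ → ℤ → Bool
eqℤ a b = ⌊ a ℤ.≟ b ⌋

eqVec : ∀ {m n} → Vec (Fin m) n → Vec (Fin m) n → Bool
eqVec [] [] = true
eqVec (x ∷ xs) (y ∷ ys) = eqFin x y ∧ eqVec xs ys

allF : ∀ {k} → (Fin k → Bool) → Bool
allF {k} p = all p (allFin k)

anyF : ∀ {k} → (Fin k → Bool) → Bool
anyF {k} p = any p (allFin k)

sumList : ∀ {A : Set} → (A → ℕ) → List A → ℕ
sumList f List.[] = 0
sumList f (x List.∷ xs) = f x + sumList f xs

sumFℤ : ∀ {k} → (Fin k → ℤ) → ℤ
sumFℤ {zero} f = + 0
sumFℤ {suc k} f = f Fin.zero ℤ.+ sumFℤ (λ j → f (Fin.suc j))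

sumFℕ : ∀ {k} → (Fin k → ℕ) → ℕ
sumFℕ {zero} f = 0
sumFℕ {suc k} f = f Fin.zero + sumFℕ (λ j → f (Fin.suc j))

allVecs : (m n : ℕ) → List (Vec (Fin m) n)
allVecs m zero = [] List.∷ List.[]
allVecs m (suc n) =
  List.concatMap (λ x → List.map (x ∷_) (allVecs m n)) (allFin m)

countList : ∀ {A : Set} → (A → Bool) → List A → ℕ
countList p xs = length (filter (λ x → Data.Bool.T? (p x)) xs)
  where import Data.Bool

IsPartition : ∀ {ℓ} → ℕ → Vec ℕ ℓ → Set
IsPartition n shape =
  (∀ r → 0 < lookup shape r) ×
  (∀ r s → toℕ r ≤ toℕ s → lookup shape s ≤ lookup shape r) ×
  (Vec.sum shape ≡ n)

-- Tabloids.  A tabloid {t} of shape `shape` (ℓ rows, French notation,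
-- row 0 = bottom = longest row) on letters 0,…,n-1 is encoded by the
-- vector  v : Vec (Fin ℓ) n  with  v[j] = the row containing letter j.
-- Row r must contain exactly shape[r] letters.

Filling : ℕ → ℕ → Set
Filling ℓ n = Vec (Fin ℓ) n

isTabloidᵇ : ∀ {ℓ n} → Vec ℕ ℓ → Filling ℓ n → Bool
isTabloidᵇ shape v = allF (λ r → eqℕ (Vec.countᵇ (eqFin r) v) (lookup shape r))

IsTabloid : ∀ {ℓ n} → Vec ℕ ℓ → Filling ℓ n → Set
IsTabloid shape v = ∀ r → Vec.countᵇ (eqFin r) v ≡ lookup shape r

-- s_i (0-based, defined for i+1 < n) swaps the letters i and i+1,
-- i.e. swaps the row-entries at positions i and i+1.
swapAdj : ∀ {A : Set} {n} → ℕ → Vec A n → Vec A n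
swapAdj zero (x ∷ y ∷ v) = y ∷ x ∷ v
swapAdj zero v = v
swapAdj (suc i) [] = []
swapAdj (suc i) (x ∷ v) = x ∷ swapAdj i v

Dom : ∀ {ℓ n} → Filling ℓ n → Filling ℓ n → Set
Dom {n = n} s t = Σ (Fin n) λ j →
  (∀ (j' : Fin n) → toℕ j' < toℕ j → lookup s j' ≡ lookup t j') ×
  (toℕ (lookup s j) < toℕ (lookup t j))

-- A totally ordered basis of tabloids, given as the list v_0 < v_1 < … < v_{k-1}

IsOrderedTabloidBasis : ∀ {ℓ n k} → Vec ℕ ℓ → Vec (Filling ℓ n) k → Set
IsOrderedTabloidBasis shape vs =
  (∀ p → IsTabloid shape (lookup vs p)) ×
  (∀ p q → lookup vs p ≡ lookup vs q → p ≡ q) ×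
  (∀ v → IsTabloid shape v → ∃ λ p → lookup vs p ≡ v)

ExtendsDom : ∀ {ℓ n k} → Vec (Filling ℓ n) k → Set
ExtendsDom vs = ∀ p q → Dom (lookup vs p) (lookup vs q) → toℕ p ≤ toℕ q

sCoef : ∀ {ℓ n k} → Vec (Filling ℓ n) k → ℕ → Fin k → Fin k → ℤ
sCoef vs i t j = if eqVec (lookup vs j) (swapAdj i (lookup vs t)) then + 1 else + 0

-- The three cases of the definition of π̄_i, for a vector c = s_i v_t
-- given by its coefficients on the basis.
isUnit : ∀ {k} → (Fin k → ℤ) → Fin k → ℤ → Bool
isUnit c j a = allF (λ j' → if eqFin j' j then eqℤ (c j') a else eqℤ (c j') (+ 0))

-- tt(c) = v_t
caseA : ∀ {k} → (Fin k → ℤ) → Fin k → Bool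
caseA c t = eqℤ (c t) (+ 1) ∧ allF (λ j → not (ltFin j t) ∨ eqℤ (c j) (+ 0))

caseB : ∀ {k} → (Fin k → ℤ) → Fin k → Bool
caseB c t = anyF (λ j → ltFin t j ∧ isUnit c j (+ 1)) ∨ isUnit c t (- (+ 1))

caseC : ∀ {k} → (Fin k → ℤ) → Fin k → Bool
caseC c t = anyF (λ j → ltFin j t ∧ isUnit c j (+ 1))

piCoef : ∀ {ℓ n k} → Vec (Filling ℓ n) k → ℕ → Fin k → Fin k → ℤ
piCoef vs i t j =
  if caseA c t then + 0
  else if caseB c t then (if eqFin j t then - (+ 1) else + 0)
  else if caseC c t then c j
  else + 0
  where
  c = sCoef vs i t

piAct : ∀ {ℓ n k} → Vec (Filling ℓ n) k → ℕ → (Fin k → ℤ) → (Fin k → ℤ)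
piAct vs i w j = sumFℤ (λ t → piCoef vs i t j ℤ.* w t)

HeckeRelations : ∀ {ℓ k} (n : ℕ) → Vec (Filling ℓ n) k → Set
HeckeRelations n vs =
  (∀ i → suc i < n → ∀ w j → piAct vs i (piAct vs i w) j ≡ - piAct vs i w j) ×
  (∀ i i' → suc i < n → suc i' < n → suc (suc i) ≤ i' →
     ∀ w j → piAct vs i (piAct vs i' w) j ≡ piAct vs i' (piAct vs i w) j) ×
  (∀ i → suc (suc i) < n → ∀ w j →
     piAct vs i (piAct vs (suc i) (piAct vs i w)) j
       ≡ piAct vs (suc i) (piAct vs i (piAct vs (suc i) w)) j)

CasesCovered : ∀ {ℓ k} (n : ℕ) → Vec (Filling ℓ n) k → Set
CasesCovered n vs = ∀ i → suc i < n → ∀ t →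
  (caseA (sCoef vs i t) t ∨ caseB (sCoef vs i t) t ∨ caseC (sCoef vs i t) t) ≡ true

-- the flag span(v_0..v_t) is π̄-stable (so it is a composition series of M̂
-- with one-dimensional factors)
FlagStable : ∀ {ℓ k} (n : ℕ) → Vec (Filling ℓ n) k → Set
FlagStable n vs = ∀ i → suc i < n → ∀ t j → toℕ t < toℕ j → piCoef vs i t j ≡ + 0

-- descent set of the t-th composition factor C_{I_t}: i ∈ I_t iff π̄_i acts by -1
inDescent : ∀ {ℓ n k} → Vec (Filling ℓ n) k → Fin k → ℕ → Bool
inDescent vs t i = eqℤ (piCoef vs i t t) (- (+ 1))

-- Symmetric/quasisymmetric functions, compared through their
-- restrictions to finitely many variables x_0,…,x_{N-1}.
-- A monomial is an exponent vector a : Vec ℕ N.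

hasContent : ∀ {N m} → Vec ℕ N → Vec (Fin N) m → Bool
hasContent {N} a seq = allF (λ c → eqℕ (Vec.countᵇ (eqFin c) seq) (lookup a c))

fundCond : ∀ {N m} → (ℕ → Bool) → ℕ → Vec (Fin N) m → Bool
fundCond I p [] = true
fundCond I p (x ∷ []) = true
fundCond I p (x ∷ y ∷ v) =
  (if I p then ltFin x y else ⌊ toℕ x ℕ.≤? toℕ y ⌋) ∧ fundCond I (suc p) (y ∷ v)

-- coefficient of x^a in F_I (degree n, N variables)
Fcoef : (n N : ℕ) → (ℕ → Bool) → Vec ℕ N → ℕ
Fcoef n N I a = countList (λ seq → fundCond I 0 seq ∧ hasContent a seq) (allVecs N n)

-- coefficient of x^a in F^Q_char(M̂) = Σ_t F_{I_t}
FQcoef : ∀ {ℓ k} (n : ℕ) → Vec (Filling ℓ n) k → (N : ℕ) → Vec ℕ N → ℕ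
FQcoef n vs N a = sumFℕ (λ t → Fcoef n N (inDescent vs t) a)

isPermᵇ : ∀ {n} → Vec (Fin n) n → Bool
isPermᵇ {n} σ = allF (λ x → allF (λ y → not (eqFin (lookup σ x) (lookup σ y)) ∨ eqFin x y))

perms : (n : ℕ) → List (Vec (Fin n) n)
perms n = filter (λ σ → Data.Bool.T? (isPermᵇ σ)) (allVecs n n)
  where import Data.Bool

σInvariant : ∀ {m n} → Vec (Fin n) n → Vec (Fin m) n → Bool
σInvariant σ u = allF (λ j → eqFin (lookup u (lookup σ j)) (lookup u j))

-- character of M^shape at σ = trace = number of tabloids fixed by σ
charM : ∀ {ℓ n} → Vec ℕ ℓ → Vec (Fin n) n → ℕ
charM {ℓ} {n} shape σ = countList (λ v → isTabloidᵇ shape v ∧ σInvariant σ v) (allVecs ℓ n)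

-- coefficient of x^a in the power sum p_{cycle type of σ}
powerCoef : ∀ {n} → Vec (Fin n) n → (N : ℕ) → Vec ℕ N → ℕ
powerCoef {n} σ N a = countList (λ u → σInvariant σ u ∧ hasContent a u) (allVecs N n)

-- n! times the coefficient of x^a in F_char(M^shape) = (1/n!) Σ_σ χ(σ) p_{ρ(σ)}
nFactFcharCoef : ∀ {ℓ} (n : ℕ) → Vec ℕ ℓ → (N : ℕ) → Vec ℕ N → ℕ
nFactFcharCoef n shape N a = sumList (λ σ → charM shape σ * powerCoef σ N a) (perms n)

SQCC : ∀ {ℓ k} (n : ℕ) → Vec ℕ ℓ → Vec (Filling ℓ n) k → Set
SQCC n shape vs =
  CasesCovered n vs ×
  HeckeRelations n vs ×
  FlagStable n vs ×
  (∀ N (a : Vec ℕ N) → (n !) * FQcoef n vs N a ≡ nFactFcharCoef n shape N a)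

{-# OPTIONS --safe #-}
module Submission where

-- The order ⊲ compares reading words (the word of a tabloid lists the rows of the letters
-- 1, 2, …) lexicographically, so π̄_i kills a tabloid with letters i, i+1 in the same row, negates
-- it if i is an ascent of its word and swaps them otherwise.  On coefficient functions W this
-- is the operator W ↦ (v ↦ W (s_i v) − W v at ascents of v, 0 elsewhere), for which the Hecke
-- relations are a check on three adjacent letters.  The descent set of the factor of a tabloid
-- is the ascent set of its word, so Σ_t F_{I_t} counts sorted biwords (a word of rows above a
-- word of variables).  On the other side, n! times the Frobenius characteristic counts pairs
-- (σ , w) of a permutation and a biword fixed by it.  Writing w = s ∘ τ with s sorted, the
-- pairs (σ , w) correspond to the pairs (τ σ , s): each sorted biword is counted n! times.

open import Defs
open import Data.Nat using (ℕ)
open import Data.Fin using (Fin)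
open import Data.Vec using (Vec)

open import Data.Bool using (Bool; true; false; T; T?; if_then_else_; _∧_; _∨_; not)
open import Data.Bool.Properties using (T-≡; T-∧; T-∨; ∨-zeroʳ)
open import Data.Nat as ℕ using (zero; suc; _+_; _*_; _!; _<_; _≤_; s<s⁻¹)
import Data.Nat.Properties as ℕ
open import Data.Fin as Fin using (zero; suc; toℕ; punchIn; punchOut)
import Data.Fin.Properties as Fin
open import Data.Fin.Permutation as Perm using (Permutation′; _⟨$⟩ʳ_; _⟨$⟩ˡ_; permutation)
open import Data.Vec as Vec using ([]; _∷_; lookup)
import Data.Vec.Properties as Vec
open import Data.Vec.Relation.Binary.Pointwise.Extensional using (ext; Pointwise-≡⇒≡)
open import Data.Vec.Relation.Unary.Linked as Linked using (Linked; []; [-]; _∷_)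
import Data.Vec.Relation.Unary.Linked.Properties as Linked
open import Data.List as List using (List; allFin; _++_; length; filter)
import Data.List.Properties as List
open import Data.List.Membership.Propositional using (_∈_; lose; find)
open import Data.List.Membership.Propositional.Properties
  using (∈-allFin; ∈-map⁺; ∈-map⁻; ∈-++⁺ˡ; ∈-++⁺ʳ; ∈-++⁻; ∈-filter⁺; ∈-filter⁻; ∈-concatMap⁺; ∈-concatMap⁻)
open import Data.List.Membership.Propositional.Properties.WithK using (unique∧set⇒bag)
open import Data.List.Relation.Binary.BagAndSetEquality using (∼bag⇒↭)
open import Data.List.Relation.Binary.Permutation.Propositional.Properties using (↭-length)
open import Data.List.Relation.Unary.All as All using ([]; _∷_)
import Data.List.Relation.Unary.All.Properties as All
open import Data.List.Relation.Unary.Any as Any using (here; there)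
import Data.List.Relation.Unary.Any.Properties as Any
open import Data.List.Relation.Unary.Unique.Propositional using (Unique; []; _∷_)
import Data.List.Relation.Unary.Unique.Propositional.Properties as Unique
open import Data.Integer as ℤ using (ℤ; +_; -_)
import Data.Integer.Properties as ℤ
open import Data.Integer.Tactic.RingSolver using (solve-∀)
open import Data.Product using (∃; _×_; _,_; proj₁; proj₂; uncurry)
open import Data.Product.Properties using (,-injective)
open import Data.Sum using (_⊎_; inj₁; inj₂; map₂; [_,_])
open import Data.Unit using (⊤; tt)
open import Algebra.Properties.CommutativeMonoid.Sum ℕ.+-0-commutativeMonoid
  using (sum; sum-permute; sum-cong-≗)
open import Function using (_∘_; id; Equivalence; Injection; mk⇔; _⇔_)
open import Function.Properties.Inverse using (↔⇒↣)
open import Relation.Binary using (tri<; tri≈; tri>)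
open import Relation.Binary.PropositionalEquality hiding ([_])
open import Relation.Nullary using (¬_; yes; no; contradiction)
open import Relation.Nullary.Decidable using (⌊_⌋; toWitness; fromWitness; _×-dec_)

-- Reflection of Boolean tests

T⇒≡ : ∀ {b} → T b → b ≡ true
T⇒≡ = Equivalence.to T-≡

¬T⇒≡ : ∀ {b} → ¬ T b → b ≡ false
¬T⇒≡ {false} _ = refl
¬T⇒≡ {true} ¬t = contradiction tt ¬t

≡⇒T : ∀ {b} → b ≡ true → T b
≡⇒T = Equivalence.from T-≡

allF⁺ : ∀ {k} {p : Fin k → Bool} → (∀ j → T (p j)) → T (allF p)
allF⁺ {k} h = All.all⁻ _ (All.universal h (allFin k))

allF⁻ : ∀ {k} {p : Fin k → Bool} → T (allF p) → ∀ j → T (p j)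
allF⁻ {k} h j = All.lookup (All.all⁺ _ (allFin k) h) (∈-allFin j)

anyF⁺ : ∀ {k} {p : Fin k → Bool} j → T (p j) → T (anyF p)
anyF⁺ j h = Any.any⁺ _ (lose (∈-allFin j) h)

anyF⁻ : ∀ {k} {p : Fin k → Bool} → T (anyF p) → ∃ λ j → T (p j)
anyF⁻ {k} h = Any.satisfied (Any.any⁻ _ (allFin k) h)

eqFin-refl : ∀ {m} (a : Fin m) → eqFin a a ≡ true
eqFin-refl a = T⇒≡ (fromWitness refl)

eqFin-≢ : ∀ {m} {a b : Fin m} → a ≢ b → eqFin a b ≡ false
eqFin-≢ a≢b = ¬T⇒≡ (a≢b ∘ toWitness)

eqVec-refl : ∀ {m n} (v : Vec (Fin m) n) → eqVec v v ≡ true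
eqVec-refl [] = refl
eqVec-refl (x ∷ v) rewrite eqFin-refl x = eqVec-refl v

eqVec⇒≡ : ∀ {m n} {v w : Vec (Fin m) n} → T (eqVec v w) → v ≡ w
eqVec⇒≡ {v = []} {[]} _ = refl
eqVec⇒≡ {v = x ∷ v} {y ∷ w} h =
  let x≡y , v≡w = Equivalence.to T-∧ h in cong₂ _∷_ (toWitness x≡y) (eqVec⇒≡ v≡w)

eqVec-≢ : ∀ {m n} {v w : Vec (Fin m) n} → v ≢ w → eqVec v w ≡ false
eqVec-≢ v≢w = ¬T⇒≡ (v≢w ∘ eqVec⇒≡)

ltFin-asym : ∀ {m} {x y : Fin m} → ltFin x y ≡ true → ltFin y x ≡ false
ltFin-asym x<y = ¬T⇒≡ λ y<x → ℕ.<-asym (toWitness (≡⇒T x<y)) (toWitness y<x)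

ltFin-trans : ∀ {m} {x y z : Fin m} → ltFin x y ≡ true → ltFin y z ≡ true → ltFin x z ≡ true
ltFin-trans x<y y<z = T⇒≡ (fromWitness (ℕ.<-trans (toWitness (≡⇒T x<y)) (toWitness (≡⇒T y<z))))

-- Adjacent transpositions of words

swapAdj-involutive : ∀ {A : Set} {n} i (v : Vec A n) → swapAdj i (swapAdj i v) ≡ v
swapAdj-involutive zero [] = refl
swapAdj-involutive zero (x ∷ []) = refl
swapAdj-involutive zero (x ∷ y ∷ v) = refl
swapAdj-involutive (suc i) [] = refl
swapAdj-involutive (suc i) (x ∷ v) = cong (x ∷_) (swapAdj-involutive i v)

countᵇ-swapAdj : ∀ {A : Set} {n} (p : A → Bool) i (v : Vec A n) →
  Vec.countᵇ p (swapAdj i v) ≡ Vec.countᵇ p v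
countᵇ-swapAdj p zero [] = refl
countᵇ-swapAdj p zero (x ∷ []) = refl
countᵇ-swapAdj p zero (x ∷ y ∷ v) with p x | p y
... | true  | true  = refl
... | true  | false = refl
... | false | true  = refl
... | false | false = refl
countᵇ-swapAdj p (suc i) [] = refl
countᵇ-swapAdj p (suc i) (x ∷ v) with p x
... | true  = cong suc (countᵇ-swapAdj p i v)
... | false = countᵇ-swapAdj p i v

IsTabloid-swapAdj : ∀ {ℓ n} (shape : Vec ℕ ℓ) i (v : Filling ℓ n) →
  IsTabloid shape v → IsTabloid shape (swapAdj i v)
IsTabloid-swapAdj shape i v tab r = trans (countᵇ-swapAdj (eqFin r) i v) (tab r)

-- For a tabloid: letter `i` lies in a strictly lower row than letter `i+1`. Out of range the value
-- is `false`, matching `swapAdj`, which is then the identity, so later statements hold for every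
-- `i`.
ascent : ∀ {ℓ n} → ℕ → Filling ℓ n → Bool
ascent zero (x ∷ y ∷ v) = ltFin x y
ascent zero _ = false
ascent (suc i) [] = false
ascent (suc i) (x ∷ v) = ascent i v

-- Position `i` is the first one changed by the swap, and at an ascent its entry grows.
ascent⇒Dom : ∀ {ℓ n} i {v : Filling ℓ n} → T (ascent i v) → Dom v (swapAdj i v)
ascent⇒Dom zero {x ∷ y ∷ v} x<y = zero , (λ _ ()) , toWitness x<y
ascent⇒Dom (suc i) {x ∷ v} asc with ascent⇒Dom i asc
... | j , agree , less = suc j , agree′ , less
  where
  agree′ : ∀ j' → toℕ j' < suc (toℕ j) → lookup (x ∷ v) j' ≡ lookup (x ∷ swapAdj i v) j'
  agree′ zero _ = refl
  agree′ (suc j') j'<j = agree j' (s<s⁻¹ j'<j)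

Dom-irrefl : ∀ {ℓ n} (v : Filling ℓ n) → ¬ Dom v v
Dom-irrefl v (_ , _ , less) = ℕ.<-irrefl refl less

-- The `down` case is recorded as an ascent of the swapped word, so that `ascent⇒Dom` also applies
-- to it, with the two words exchanged.
data Step {ℓ n} (i : ℕ) (v : Filling ℓ n) : Set where
  up   : T (ascent i v) → Step i v
  flat : swapAdj i v ≡ v → Step i v
  down : T (ascent i (swapAdj i v)) → Step i v

step : ∀ {ℓ n} i (v : Filling ℓ n) → Step i v
step zero [] = flat refl
step zero (x ∷ []) = flat refl
step zero (x ∷ y ∷ v) with Fin.<-cmp x y
... | tri< x<y _ _ = up (fromWitness x<y)
... | tri≈ _ refl _ = flat refl
... | tri> _ _ y<x = down (fromWitness y<x)
step (suc i) [] = flat refl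
step (suc i) (x ∷ v) with step i v
... | up asc = up asc
... | flat eq = flat (cong (x ∷_) eq)
... | down asc = down asc

ascent-asym : ∀ {ℓ n} i (v : Filling ℓ n) → T (ascent i v) → ¬ T (ascent i (swapAdj i v))
ascent-asym zero (x ∷ y ∷ v) x<y y<x = ℕ.<-asym (toWitness x<y) (toWitness y<x)
ascent-asym (suc i) (x ∷ v) = ascent-asym i v

-- The 0-Hecke action on functions of words

-- The action of π̄_i read off on coefficients. At an ascent `v`, the tabloid `v` contributes
-- `- W v` to its own coefficient and the tabloid `s_i v` is moved to `v`; no tabloid contributes at
-- any other `v`. Defining it on all words permits induction along the letters.
Π : ∀ {ℓ n} → ℕ → (Filling ℓ n → ℤ) → Filling ℓ n → ℤ
Π i W v = if ascent i v then W (swapAdj i v) ℤ.- W v else + 0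

-- `Π` evaluates `W` at `v` and at its swap, so agreement on a swap-closed set of words suffices.
-- The set will be the tabloids.
Π-cong : ∀ {ℓ n} (P : Filling ℓ n → Set) → ∀ i → (∀ v → P v → P (swapAdj i v)) →
  ∀ {W W′} → (∀ v → P v → W v ≡ W′ v) → ∀ v → P v → Π i W v ≡ Π i W′ v
Π-cong P i closed W≗W′ v Pv with ascent i v
... | true = cong₂ ℤ._-_ (W≗W′ _ (closed v Pv)) (W≗W′ v Pv)
... | false = refl

-- At an ascent `v` the swapped word has no ascent at `i`, so the first term of the outer difference
-- vanishes.
Π-quadratic : ∀ {ℓ n} i (W : Filling ℓ n → ℤ) v → Π i (Π i W) v ≡ - Π i W v
Π-quadratic i W v with ascent i v in eq
... | false = refl
... | true rewrite ¬T⇒≡ (ascent-asym i v (≡⇒T eq)) = ℤ.+-identityˡ _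

-- The two operators touch disjoint pairs of positions. If both positions are ascents, each side is
-- the same second difference of four values of `W`; otherwise both vanish.
Π-comm : ∀ {ℓ n} i i′ → suc (suc i) ≤ i′ → (W : Filling ℓ n → ℤ) → ∀ v →
  Π i (Π i′ W) v ≡ Π i′ (Π i W) v
Π-comm zero (suc (suc i′)) _ W [] = refl
Π-comm zero (suc (suc i′)) _ W (x ∷ []) = refl
Π-comm zero (suc (suc i′)) _ W (x ∷ y ∷ v) with ltFin x y | ascent i′ v
... | true  | true  =
  lemma (W (y ∷ x ∷ swapAdj i′ v)) (W (y ∷ x ∷ v)) (W (x ∷ y ∷ swapAdj i′ v)) (W (x ∷ y ∷ v))
  where
  lemma : ∀ a b c d → (a ℤ.- b) ℤ.- (c ℤ.- d) ≡ (a ℤ.- c) ℤ.- (b ℤ.- d)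
  lemma = solve-∀
... | true  | false = refl
... | false | true  = refl
... | false | false = refl
Π-comm zero (suc zero) (ℕ.s≤s ()) W v
Π-comm (suc i) (suc i′) _ W [] = refl
Π-comm (suc i) (suc i′) (ℕ.s≤s i≤i′) W (x ∷ v) = Π-comm i i′ i≤i′ (W ∘ (x ∷_)) v

-- Only the three letters from position `i` on matter. If they increase strictly, both sides are the
-- signed sum of `W` over their six rearrangements; in every other case both sides vanish.
Π-braid : ∀ {ℓ n} i (W : Filling ℓ n → ℤ) v →
  Π i (Π (suc i) (Π i W)) v ≡ Π (suc i) (Π i (Π (suc i) W)) v
Π-braid zero W [] = refl
Π-braid zero W (x ∷ []) = refl
Π-braid zero W (x ∷ y ∷ []) with ltFin x y
... | true = refl
... | false = refl
Π-braid zero W (x ∷ y ∷ z ∷ v) with ltFin x y in xy | ltFin y z in yz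
... | false | false = refl
... | false | true rewrite ltFin-asym yz with ltFin x z
...   | true = refl
...   | false = refl
Π-braid zero W (x ∷ y ∷ z ∷ v) | true | false rewrite ltFin-asym xy with ltFin x z
...   | true = refl
...   | false = refl
Π-braid zero W (x ∷ y ∷ z ∷ v) | true | true
  rewrite ltFin-asym xy | ltFin-asym yz | ltFin-trans xy yz =
  lemma (W (z ∷ y ∷ x ∷ v)) (W (y ∷ z ∷ x ∷ v)) (W (z ∷ x ∷ y ∷ v))
        (W (x ∷ z ∷ y ∷ v)) (W (y ∷ x ∷ z ∷ v)) (W (x ∷ y ∷ z ∷ v))
  where
  lemma : ∀ a b c d e f → ((a ℤ.- b) ℤ.- + 0) ℤ.- ((c ℤ.- d) ℤ.- (e ℤ.- f)) ≡
                          ((a ℤ.- c) ℤ.- + 0) ℤ.- ((b ℤ.- e) ℤ.- (d ℤ.- f))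
  lemma = solve-∀
Π-braid (suc i) W [] = refl
Π-braid (suc i) W (x ∷ v) = Π-braid i (W ∘ (x ∷_)) v

-- The action on the basis

δ : ∀ {k} → Fin k → Fin k → ℤ
δ q j = if eqFin j q then + 1 else + 0

δ-refl : ∀ {k} (q : Fin k) → δ q q ≡ + 1
δ-refl q rewrite eqFin-refl q = refl

δ-≢ : ∀ {k} {q j : Fin k} → j ≢ q → δ q j ≡ + 0
δ-≢ j≢q rewrite eqFin-≢ j≢q = refl

δ-cong : ∀ {k m} {q j : Fin k} {q′ j′ : Fin m} →
  (j ≡ q → j′ ≡ q′) → (j′ ≡ q′ → j ≡ q) → δ q j ≡ δ q′ j′
δ-cong {q = q} {j} {q′} {j′} to from with j Fin.≟ q | j′ Fin.≟ q′
... | yes _ | yes _ = refl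
... | yes p | no ¬p′ = contradiction (to p) ¬p′
... | no ¬p | yes p′ = contradiction (from p′) ¬p
... | no _ | no _ = refl

sumFℤ-cong : ∀ {k} {f g : Fin k → ℤ} → (∀ t → f t ≡ g t) → sumFℤ f ≡ sumFℤ g
sumFℤ-cong {zero} f≗g = refl
sumFℤ-cong {suc k} f≗g = cong₂ ℤ._+_ (f≗g zero) (sumFℤ-cong (f≗g ∘ suc))

sumFℤ-zero : ∀ {k} {f : Fin k → ℤ} → (∀ t → f t ≡ + 0) → sumFℤ f ≡ + 0
sumFℤ-zero {zero} f≗0 = refl
sumFℤ-zero {suc k} f≗0 = cong₂ ℤ._+_ (f≗0 zero) (sumFℤ-zero (f≗0 ∘ suc))

sumFℤ-minus : ∀ {k} (f g : Fin k → ℤ) →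
  sumFℤ (λ t → f t ℤ.- g t) ≡ sumFℤ f ℤ.- sumFℤ g
sumFℤ-minus {zero} f g = refl
sumFℤ-minus {suc k} f g rewrite sumFℤ-minus (f ∘ suc) (g ∘ suc) =
  exchange (f zero) (g zero) (sumFℤ (f ∘ suc)) (sumFℤ (g ∘ suc))
  where
  exchange : ∀ a b c d → (a ℤ.- b) ℤ.+ (c ℤ.- d) ≡ (a ℤ.+ c) ℤ.- (b ℤ.+ d)
  exchange = solve-∀

sumFℤ-single : ∀ {k} (f : Fin k → ℤ) j → (∀ t → t ≢ j → f t ≡ + 0) → sumFℤ f ≡ f j
sumFℤ-single f zero off =
  trans (cong (λ z → f zero ℤ.+ z) (sumFℤ-zero λ t → off (suc t) λ ())) (ℤ.+-identityʳ _)
sumFℤ-single f (suc j) off =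
  trans (cong₂ ℤ._+_ (off zero λ ()) (sumFℤ-single (f ∘ suc) j λ t t≢j → off (suc t) (t≢j ∘ Fin.suc-injective)))
        (ℤ.+-identityˡ _)

toℕ-<⇒≢ : ∀ {k} {i j : Fin k} → toℕ i < toℕ j → i ≢ j
toℕ-<⇒≢ i<j refl = ℕ.<-irrefl refl i<j

-- Since `s_i` permutes tabloids, the vector `s_i v_t` is a single basis element `v_q`. The case of
-- the definition of π̄_i is then decided by comparing `t` with `q`: equal gives A, `t` before `q`
-- gives B, `t` after `q` gives C.
module UnitVector {k} {c : Fin k → ℤ} {q : Fin k} (c≗δ : ∀ j → c j ≡ δ q j) where

  isUnit-support : T (isUnit c q (+ 1))
  isUnit-support = allF⁺ check
    where
    check : ∀ j → T (if eqFin j q then eqℤ (c j) (+ 1) else eqℤ (c j) (+ 0))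
    check j rewrite c≗δ j with eqFin j q
    ... | true = tt
    ... | false = tt

  isUnit⇒coefficient : ∀ {j a} → T (isUnit c j a) → δ q j ≡ a
  isUnit⇒coefficient {j} {a} unit = trans (sym (c≗δ j)) (toWitness (subst T reduce (allF⁻ unit j)))
    where
    reduce : (if eqFin j j then eqℤ (c j) a else eqℤ (c j) (+ 0)) ≡ eqℤ (c j) a
    reduce rewrite eqFin-refl j = refl

  isUnit-one⇒support : ∀ {j} → T (isUnit c j (+ 1)) → j ≡ q
  isUnit-one⇒support {j} unit with j Fin.≟ q | isUnit⇒coefficient {j} unit
  ... | yes j≡q | _ = j≡q

  -- All coefficients are 0 or 1, so the alternative `s_i v_t = - v_t` never occurs.
  ¬isUnit-minus-one : ∀ {j} → ¬ T (isUnit c j (- (+ 1)))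
  ¬isUnit-minus-one {j} unit with eqFin j q | isUnit⇒coefficient {j} unit
  ... | true  | ()
  ... | false | ()

  caseA-support : caseA c q ≡ true
  caseA-support = T⇒≡ (Equivalence.from T-∧ (leading , allF⁺ earlier))
    where
    leading : T (eqℤ (c q) (+ 1))
    leading rewrite c≗δ q | δ-refl q = tt
    earlier : ∀ j → T (not (ltFin j q) ∨ eqℤ (c j) (+ 0))
    earlier j with toℕ j ℕ.<? toℕ q
    ... | no _ = tt
    ... | yes j<q rewrite c≗δ j | δ-≢ (toℕ-<⇒≢ j<q) = tt

  caseA-≢ : ∀ {t} → t ≢ q → caseA c t ≡ false
  caseA-≢ {t} t≢q rewrite c≗δ t | δ-≢ t≢q = refl

  caseB-before : ∀ {t} → toℕ t < toℕ q → caseB c t ≡ true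
  caseB-before t<q =
    T⇒≡ (Equivalence.from T-∨ (inj₁ (anyF⁺ q (Equivalence.from T-∧ (fromWitness t<q , isUnit-support)))))

  caseB-after : ∀ {t} → toℕ q < toℕ t → caseB c t ≡ false
  caseB-after {t} q<t = ¬T⇒≡ (refute ∘ Equivalence.to T-∨)
    where
    refute : ¬ (T (anyF (λ j → ltFin t j ∧ isUnit c j (+ 1))) ⊎ T (isUnit c t (- (+ 1))))
    refute (inj₂ unit) = ¬isUnit-minus-one {t} unit
    refute (inj₁ later) with anyF⁻ later
    ... | j , h =
      let t<j , unit = Equivalence.to T-∧ h in
      ℕ.<-asym q<t (subst (λ j → toℕ t < toℕ j) (isUnit-one⇒support {j} unit) (toWitness t<j))

  caseC-after : ∀ {t} → toℕ q < toℕ t → caseC c t ≡ true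
  caseC-after q<t = T⇒≡ (anyF⁺ q (Equivalence.from T-∧ (fromWitness q<t , isUnit-support)))

module Basis {ℓ k n} (shape : Vec ℕ ℓ) (vs : Vec (Filling ℓ n) k)
  (basis : IsOrderedTabloidBasis shape vs) (extends : ExtendsDom vs) where

  tabloid : ∀ t → IsTabloid shape (lookup vs t)
  tabloid = proj₁ basis

  index-injective : ∀ p q → lookup vs p ≡ lookup vs q → p ≡ q
  index-injective = proj₁ (proj₂ basis)

  -- The extension hypothesis gives the weak inequality, and irreflexivity of `Dom` makes it strict.
  Dom⇒< : ∀ {p q} → Dom (lookup vs p) (lookup vs q) → toℕ p < toℕ q
  Dom⇒< {p} {q} dom = ℕ.≤∧≢⇒< (extends p q dom) λ p≡q →
    Dom-irrefl (lookup vs p) (subst (Dom (lookup vs p)) (cong (lookup vs) (sym (Fin.toℕ-injective p≡q))) dom)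

  swapIndex : ∀ i t → ∃ λ q → lookup vs q ≡ swapAdj i (lookup vs t)
  swapIndex i t = proj₂ (proj₂ basis) _ (IsTabloid-swapAdj shape i _ (tabloid t))

  eqVec-index : ∀ q {v} → lookup vs q ≡ v → ∀ j → eqVec (lookup vs j) v ≡ eqFin j q
  eqVec-index q refl j with j Fin.≟ q
  ... | yes refl = eqVec-refl (lookup vs j)
  ... | no j≢q = eqVec-≢ (j≢q ∘ index-injective j q)

  sCoef-δ : ∀ i t {q} → lookup vs q ≡ swapAdj i (lookup vs t) → ∀ j → sCoef vs i t j ≡ δ q j
  sCoef-δ i t {q} eq j rewrite eqVec-index q eq j = refl

  -- Each constructor joins the combinatorial situation of `v_t`, the case of the definition that
  -- applies, and the resulting column `t` of the matrix of π̄_i.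
  data Outcome (i : ℕ) (t : Fin k) : Set where
    killed  : swapAdj i (lookup vs t) ≡ lookup vs t →
              caseA (sCoef vs i t) t ≡ true →
              (∀ j → piCoef vs i t j ≡ + 0) → Outcome i t
    negated : T (ascent i (lookup vs t)) →
              caseB (sCoef vs i t) t ≡ true →
              (∀ j → piCoef vs i t j ≡ - δ t j) → Outcome i t
    moved   : ∀ q → lookup vs q ≡ swapAdj i (lookup vs t) → T (ascent i (lookup vs q)) →
              toℕ q < toℕ t →
              caseC (sCoef vs i t) t ≡ true →
              (∀ j → piCoef vs i t j ≡ δ q j) → Outcome i t

  outcome : ∀ i t → Outcome i t
  outcome i t with swapIndex i t | step i (lookup vs t)
  ... | _ | flat fixed = killed fixed a coef
    where
    open UnitVector (sCoef-δ i t (sym fixed))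
    a = caseA-support
    coef : ∀ j → piCoef vs i t j ≡ + 0
    coef j rewrite a = refl
  ... | q , eq | up asc = negated asc b coef
    where
    t<q = Dom⇒< (subst (Dom (lookup vs t)) (sym eq) (ascent⇒Dom i asc))
    open UnitVector (sCoef-δ i t eq)
    b = caseB-before t<q
    coef : ∀ j → piCoef vs i t j ≡ - δ t j
    coef j rewrite caseA-≢ (toℕ-<⇒≢ t<q) | b with eqFin j t
    ... | true = refl
    ... | false = refl
  ... | q , eq | down asc = moved q eq asc′ q<t c coef
    where
    asc′ = subst (T ∘ ascent i) (sym eq) asc
    -- The swap is an involution, so `v_t` is the swap of `v_q` at an ascent of `v_q`.
    q<t = Dom⇒< (subst (Dom (lookup vs q))
      (trans (cong (swapAdj i) eq) (swapAdj-involutive i _)) (ascent⇒Dom i asc′))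
    open UnitVector (sCoef-δ i t eq)
    c = caseC-after q<t
    coef : ∀ j → piCoef vs i t j ≡ δ q j
    coef j rewrite caseA-≢ (toℕ-<⇒≢ q<t ∘ sym) | caseB-after q<t | c = sCoef-δ i t eq j

  casesCovered : CasesCovered n vs
  casesCovered i _ t with outcome i t
  ... | killed _ a _ rewrite a = refl
  ... | negated _ b _ rewrite b = ∨-zeroʳ _
  ... | moved _ _ _ _ c _ rewrite c = trans (cong (caseA (sCoef vs i t) t ∨_) (∨-zeroʳ _)) (∨-zeroʳ _)

  flagStable : FlagStable n vs
  flagStable i _ t j t<j with outcome i t
  ... | killed _ _ coef = coef j
  ... | negated _ _ coef = trans (coef j) (cong -_ (δ-≢ (toℕ-<⇒≢ t<j ∘ sym)))
  ... | moved q _ _ q<t _ coef = trans (coef j) (δ-≢ (toℕ-<⇒≢ (ℕ.<-trans q<t t<j) ∘ sym))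

  -- The diagonal entry at `t` is -1 exactly when `v_t` is negated; a killed or moved tabloid has
  -- diagonal entry 0.
  inDescent≡ascent : ∀ t i → inDescent vs t i ≡ ascent i (lookup vs t)
  inDescent≡ascent t i with outcome i t
  ... | killed fixed _ coef rewrite coef t = sym (¬T⇒≡ λ asc →
          ascent-asym i _ asc (subst (T ∘ ascent i) (sym fixed) asc))
  ... | negated asc _ coef rewrite coef t | δ-refl t = sym (T⇒≡ asc)
  ... | moved q eq asc q<t _ coef rewrite coef t | δ-≢ (toℕ-<⇒≢ q<t ∘ sym) =
          sym (¬T⇒≡ λ asc′ → ascent-asym i _ asc′ (subst (T ∘ ascent i) eq asc))

  -- For fixed `t`, the function `λ v → ι v t` is the indicator function of the tabloid `v_t` on all
  -- words.
  ι : Filling ℓ n → Fin k → ℤ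
  ι v t = if eqVec (lookup vs t) v then + 1 else + 0

  -- Compares the matrix of π̄_i, given by columns `t`, with `Π`, given by rows `j`. In a row where
  -- `v_j` has an ascent at `i`, the nonzero entries are -1 at `t = j` and 1 where `v_t` is the swap
  -- of `v_j`; other rows are zero.
  piCoef-dual : ∀ i t j → piCoef vs i t j ≡ Π i (λ v → ι v t) (lookup vs j)
  piCoef-dual i t j with swapIndex i j | ascent i (lookup vs j) in asc-j | outcome i t
  ... | q′ , eq′ | true | killed fixed _ coef
    rewrite eqVec-index q′ eq′ t | eqVec-index j refl t =
      trans (coef j) (sym (cong₂ ℤ._-_ (δ-≢ t≢q′) (δ-≢ t≢j)))
    where
    t≢j : t ≢ j
    t≢j refl = ascent-asym i _ (≡⇒T asc-j) (subst (T ∘ ascent i) (sym fixed) (≡⇒T asc-j))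
    t≢q′ : t ≢ q′
    t≢q′ refl = t≢j (index-injective t j (begin
      lookup vs t                         ≡⟨ fixed ⟨
      swapAdj i (lookup vs t)             ≡⟨ cong (swapAdj i) eq′ ⟩
      swapAdj i (swapAdj i (lookup vs j)) ≡⟨ swapAdj-involutive i _ ⟩
      lookup vs j                         ∎))
      where open ≡-Reasoning
  ... | q′ , eq′ | true | negated asc _ coef
    rewrite eqVec-index q′ eq′ t | eqVec-index j refl t = begin
      piCoef vs i t j   ≡⟨ coef j ⟩
      - δ t j           ≡⟨ cong -_ (δ-cong sym sym) ⟩
      - δ j t           ≡⟨ ℤ.+-identityˡ _ ⟨
      + 0 ℤ.- δ j t     ≡⟨ cong (ℤ._- δ j t) (δ-≢ t≢q′) ⟨
      δ q′ t ℤ.- δ j t  ∎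
    where
    open ≡-Reasoning
    t≢q′ : t ≢ q′
    t≢q′ refl = ascent-asym i _ (≡⇒T asc-j) (subst (T ∘ ascent i) eq′ asc)
  ... | q′ , eq′ | true | moved q eq asc q<t _ coef
    rewrite eqVec-index q′ eq′ t | eqVec-index j refl t = begin
      piCoef vs i t j   ≡⟨ coef j ⟩
      -- Both deltas test whether `v_t` and `v_j` are exchanged by `s_i`.
      δ q j             ≡⟨ δ-cong (λ { refl → index-injective _ _ (swapped eq eq′) })
                                  (λ { refl → index-injective _ _ (swapped eq′ eq) }) ⟩
      δ q′ t            ≡⟨ ℤ.+-identityʳ _ ⟨
      δ q′ t ℤ.- + 0    ≡⟨ cong (λ z → δ q′ t ℤ.- z) (δ-≢ t≢j) ⟨
      δ q′ t ℤ.- δ j t  ∎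
    where
    open ≡-Reasoning
    t≢j : t ≢ j
    t≢j refl = ascent-asym i _ (≡⇒T asc-j) (subst (T ∘ ascent i) eq asc)
    swapped : ∀ {v w x : Filling ℓ n} → v ≡ swapAdj i w → x ≡ swapAdj i v → w ≡ x
    swapped refl refl = sym (swapAdj-involutive i _)
  ... | _ | false | killed _ _ coef = coef j
  ... | _ | false | negated asc _ coef =
    trans (coef j) (cong -_ (δ-≢ λ { refl → contradiction (trans (sym asc-j) (T⇒≡ asc)) λ () }))
  ... | _ | false | moved q _ asc _ _ coef =
    trans (coef j) (δ-≢ λ { refl → contradiction (trans (sym asc-j) (T⇒≡ asc)) λ () })

  -- Turns a coefficient vector into a function on all words that vanishes off the tabloids, where
  -- the identities for `Π` are available.
  extend : (Fin k → ℤ) → Filling ℓ n → ℤ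
  extend w v = sumFℤ (λ t → ι v t ℤ.* w t)

  extend-lookup : ∀ w j → extend w (lookup vs j) ≡ w j
  extend-lookup w j = trans (sumFℤ-single _ j off) on
    where
    off : ∀ t → t ≢ j → ι (lookup vs j) t ℤ.* w t ≡ + 0
    off t t≢j rewrite eqVec-index j refl t | eqFin-≢ t≢j = refl
    on : ι (lookup vs j) j ℤ.* w j ≡ w j
    on rewrite eqVec-index j refl j | eqFin-refl j = ℤ.*-identityˡ (w j)

  -- `Π` is linear in the function, so this is the combination of `piCoef-dual` over all `t` with
  -- weights `w t`.
  piAct-Π : ∀ i w j → piAct vs i w j ≡ Π i (extend w) (lookup vs j)
  piAct-Π i w j = trans (sumFℤ-cong λ t → cong (ℤ._* w t) (piCoef-dual i t j)) expand
    where
    expand : sumFℤ (λ t → Π i (λ v → ι v t) (lookup vs j) ℤ.* w t) ≡ Π i (extend w) (lookup vs j)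
    expand with ascent i (lookup vs j)
    ... | true = trans
      (sumFℤ-cong λ t → distrib (ι (swapAdj i (lookup vs j)) t) (ι (lookup vs j) t) (w t))
      (sumFℤ-minus (λ t → ι (swapAdj i (lookup vs j)) t ℤ.* w t) (λ t → ι (lookup vs j) t ℤ.* w t))
      where
      distrib : ∀ a b c → (a ℤ.- b) ℤ.* c ≡ a ℤ.* c ℤ.- b ℤ.* c
      distrib = solve-∀
    ... | false = sumFℤ-zero {f = λ t → + 0 ℤ.* w t} (λ _ → refl)

  extend-piAct : ∀ i w v → IsTabloid shape v → extend (piAct vs i w) v ≡ Π i (extend w) v
  extend-piAct i w v tab with proj₂ (proj₂ basis) v tab
  ... | j , refl = trans (extend-lookup _ j) (piAct-Π i w j)

  Π-cong-tabloid : ∀ i {W W′ : Filling ℓ n → ℤ} → (∀ v → IsTabloid shape v → W v ≡ W′ v) →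
    ∀ v → IsTabloid shape v → Π i W v ≡ Π i W′ v
  Π-cong-tabloid i = Π-cong (IsTabloid shape) i (IsTabloid-swapAdj shape i)

  extend-piAct² : ∀ i i′ w v → IsTabloid shape v →
    extend (piAct vs i (piAct vs i′ w)) v ≡ Π i (Π i′ (extend w)) v
  extend-piAct² i i′ w v tab =
    trans (extend-piAct i _ v tab) (Π-cong-tabloid i (extend-piAct i′ w) v tab)

  piAct-Π² : ∀ i i′ w j → piAct vs i (piAct vs i′ w) j ≡ Π i (Π i′ (extend w)) (lookup vs j)
  piAct-Π² i i′ w j = trans (sym (extend-lookup _ j)) (extend-piAct² i i′ w _ (tabloid j))

  piAct-Π³ : ∀ i i′ i″ w j → piAct vs i (piAct vs i′ (piAct vs i″ w)) j ≡
    Π i (Π i′ (Π i″ (extend w))) (lookup vs j)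
  piAct-Π³ i i′ i″ w j =
    trans (piAct-Π i _ j) (Π-cong-tabloid i (extend-piAct² i′ i″ w) _ (tabloid j))

  heckeRelations : HeckeRelations n vs
  heckeRelations = quadratic , commuting , braid
    where
    open ≡-Reasoning
    quadratic : ∀ i → suc i < n → ∀ w j → piAct vs i (piAct vs i w) j ≡ - piAct vs i w j
    quadratic i _ w j = begin
      piAct vs i (piAct vs i w) j               ≡⟨ piAct-Π² i i w j ⟩
      Π i (Π i (extend w)) (lookup vs j)        ≡⟨ Π-quadratic i (extend w) (lookup vs j) ⟩
      - Π i (extend w) (lookup vs j)            ≡⟨ cong -_ (piAct-Π i w j) ⟨
      - piAct vs i w j                          ∎
    commuting : ∀ i i′ → suc i < n → suc i′ < n → suc (suc i) ≤ i′ → ∀ w j →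
      piAct vs i (piAct vs i′ w) j ≡ piAct vs i′ (piAct vs i w) j
    commuting i i′ _ _ far w j = begin
      piAct vs i (piAct vs i′ w) j              ≡⟨ piAct-Π² i i′ w j ⟩
      Π i (Π i′ (extend w)) (lookup vs j)       ≡⟨ Π-comm i i′ far (extend w) (lookup vs j) ⟩
      Π i′ (Π i (extend w)) (lookup vs j)       ≡⟨ piAct-Π² i′ i w j ⟨
      piAct vs i′ (piAct vs i w) j              ∎
    braid : ∀ i → suc (suc i) < n → ∀ w j →
      piAct vs i (piAct vs (suc i) (piAct vs i w)) j ≡
      piAct vs (suc i) (piAct vs i (piAct vs (suc i) w)) j
    braid i _ w j = begin
      piAct vs i (piAct vs (suc i) (piAct vs i w)) j          ≡⟨ piAct-Π³ i (suc i) i w j ⟩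
      Π i (Π (suc i) (Π i (extend w))) (lookup vs j)          ≡⟨ Π-braid i (extend w) (lookup vs j) ⟩
      Π (suc i) (Π i (Π (suc i) (extend w))) (lookup vs j)    ≡⟨ piAct-Π³ (suc i) i (suc i) w j ⟨
      piAct vs (suc i) (piAct vs i (piAct vs (suc i) w)) j    ∎

-- Counting by exhaustive lists without repetition

-- States that exactly `m` elements satisfy `P`. Elements are counted, not proofs of `P`.
record Counts {A : Set} (P : A → Set) (m : ℕ) : Set where
  field
    elements : List A
    unique   : Unique elements
    sound    : ∀ {x} → x ∈ elements → P x
    complete : ∀ {x} → P x → x ∈ elements
    size     : length elements ≡ m

open Counts

-- Injectivity is asked only between members of the list, because the maps used for counting are
-- known to be injective only on the counted elements.
Unique-map : ∀ {A B : Set} {f : A → B} {xs} →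
  (∀ {x y} → x ∈ xs → y ∈ xs → f x ≡ f y → x ≡ y) → Unique xs → Unique (List.map f xs)
Unique-map inj [] = []
Unique-map inj (x∉xs ∷ xs!) =
  All.map⁺ (All.tabulate λ y∈xs fx≡fy → All.lookup x∉xs y∈xs (inj (here refl) (there y∈xs) fx≡fy)) ∷
  Unique-map (λ x∈ y∈ → inj (there x∈) (there y∈)) xs!

Counts-bijection : ∀ {A B : Set} {P : A → Set} {Q : B → Set} {m m′} (f : A → B) →
  (∀ {x} → P x → Q (f x)) →
  (∀ {x y} → P x → P y → f x ≡ f y → x ≡ y) →
  (∀ {y} → Q y → ∃ λ x → P x × f x ≡ y) →
  Counts P m → Counts Q m′ → m ≡ m′
Counts-bijection {A} {B} f maps inj surj p q = begin
  _                               ≡⟨ size p ⟨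
  length (elements p)             ≡⟨ List.length-map f (elements p) ⟨
  -- Two lists without repetition that have the same members are permutations of each other.
  length (List.map f (elements p)) ≡⟨ ↭-length (∼bag⇒↭ (unique∧set⇒bag image-unique (unique q) same)) ⟩
  length (elements q)             ≡⟨ size q ⟩
  _                               ∎
  where
  open ≡-Reasoning
  image-unique = Unique-map (λ x∈ y∈ → inj (sound p x∈) (sound p y∈)) (unique p)
  into : ∀ {y} → y ∈ List.map f (elements p) → y ∈ elements q
  into y∈ with ∈-map⁻ f y∈
  ... | x , x∈ , refl = complete q (maps (sound p x∈))
  onto : ∀ {y} → y ∈ elements q → y ∈ List.map f (elements p)
  onto y∈ with surj (sound q y∈)
  ... | x , Px , refl = ∈-map⁺ f (complete p Px)
  same : ∀ {y} → (y ∈ List.map f (elements p)) ⇔ (y ∈ elements q)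
  same = mk⇔ into onto

-- The fibres are concatenated; tagging each element with its base point keeps different fibres
-- disjoint.
Counts-Σ : ∀ {A B : Set} {Q : A → B → Set} {c : A → ℕ} (xs : List A) → Unique xs →
  (∀ x → Counts (Q x) (c x)) →
  Counts (λ xy → proj₁ xy ∈ xs × Q (proj₁ xy) (proj₂ xy)) (sumList c xs)
Counts-Σ List.[] _ q = record
  { elements = List.[] ; unique = [] ; sound = λ () ; complete = λ () ; size = refl }
Counts-Σ {A} {B} {Q} (x List.∷ xs) (x∉xs ∷ xs!) q = record
  { elements = fibre ++ elements rest
  ; unique = Unique.++⁺ (Unique.map⁺ (proj₂ ∘ ,-injective) (unique (q x))) (unique rest) disjoint
  ; sound = [ fibre-sound , (λ z∈ → let y∈ , Qy = sound rest z∈ in there y∈ , Qy) ] ∘ ∈-++⁻ fibre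
  ; complete = λ { (here refl , Qy) → ∈-++⁺ˡ (∈-map⁺ (x ,_) (complete (q x) Qy))
                 ; (there y∈ , Qy) → ∈-++⁺ʳ fibre (complete rest (y∈ , Qy)) }
  ; size = trans (List.length-++ fibre)
      (cong₂ _+_ (trans (List.length-map (x ,_) (elements (q x))) (size (q x))) (size rest))
  }
  where
  rest = Counts-Σ xs xs! q
  fibre = List.map (x ,_) (elements (q x))
  fibre-sound : ∀ {z} → z ∈ fibre → proj₁ z ∈ (x List.∷ xs) × Q (proj₁ z) (proj₂ z)
  fibre-sound z∈ with ∈-map⁻ (x ,_) z∈
  ... | y , y∈ , refl = here refl , sound (q x) y∈
  disjoint : ∀ {z} → ¬ (z ∈ fibre × z ∈ elements rest)
  disjoint (z∈ , z∈′) with ∈-map⁻ (x ,_) z∈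
  ... | y , _ , refl = All.lookup x∉xs (proj₁ (sound rest z∈′)) refl

Counts-× : ∀ {A B : Set} {P : A → Set} {Q : B → Set} {m m′} → Counts P m → Counts Q m′ →
  Counts (λ xy → P (proj₁ xy) × Q (proj₂ xy)) (m * m′)
Counts-× {m′ = m′} p q = record
  { elements = elements pairs
  ; unique = unique pairs
  ; sound = λ z∈ → let x∈ , Qy = sound pairs z∈ in sound p x∈ , Qy
  ; complete = λ (Px , Qy) → complete pairs (complete p Px , Qy)
  ; size = trans (size pairs) (trans (constant (elements p)) (cong (_* m′) (size p)))
  }
  where
  pairs = Counts-Σ (elements p) (unique p) (λ _ → q)
  constant : ∀ {A : Set} (xs : List A) → sumList (λ _ → m′) xs ≡ length xs * m′
  constant List.[] = refl
  constant (x List.∷ xs) = cong (λ c → m′ + c) (constant xs)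

Counts-sumFℕ : ∀ {k} {B : Set} {Q : Fin k → B → Set} {c : Fin k → ℕ} →
  (∀ t → Counts (Q t) (c t)) → Counts (λ ty → Q (proj₁ ty) (proj₂ ty)) (sumFℕ c)
Counts-sumFℕ {k} {c = c} q = record
  { elements = elements total
  ; unique = unique total
  ; sound = proj₂ ∘ sound total
  ; complete = λ Qy → complete total (∈-allFin _ , Qy)
  ; size = trans (size total) (sumList-tabulate id c)
  }
  where
  total = Counts-Σ (allFin k) (Unique.allFin⁺ k) q
  sumList-tabulate : ∀ {A : Set} {k} (f : Fin k → A) (c : A → ℕ) →
    sumList c (List.tabulate f) ≡ sumFℕ (c ∘ f)
  sumList-tabulate {k = zero} f c = refl
  sumList-tabulate {k = suc k} f c = cong (λ s → c (f zero) + s) (sumList-tabulate (f ∘ suc) c)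

allVecs-complete : ∀ {m n} (v : Vec (Fin m) n) → v ∈ allVecs m n
allVecs-complete [] = here refl
allVecs-complete (x ∷ v) =
  ∈-concatMap⁺ _ (lose (∈-allFin x) (∈-map⁺ (x ∷_) (allVecs-complete v)))

allVecs-unique : ∀ m n → Unique (allVecs m n)
allVecs-unique m zero = [] ∷ []
allVecs-unique m (suc n) = prepend (allFin m) (Unique.allFin⁺ m)
  where
  prepend : ∀ xs → Unique xs → Unique (List.concatMap (λ x → List.map (x ∷_) (allVecs m n)) xs)
  prepend List.[] _ = []
  prepend (x List.∷ xs) (x∉xs ∷ xs!) =
    Unique.++⁺ (Unique.map⁺ Vec.∷-injectiveʳ (allVecs-unique m n)) (prepend xs xs!) disjoint
    where
    disjoint : ∀ {v} → ¬ (v ∈ List.map (x ∷_) (allVecs m n) ×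
      v ∈ List.concatMap (λ x → List.map (x ∷_) (allVecs m n)) xs)
    disjoint (v∈ , v∈′) with ∈-map⁻ (x ∷_) v∈ | find (∈-concatMap⁻ (λ x → List.map (x ∷_) (allVecs m n)) {xs} v∈′)
    ... | _ , _ , refl | y , y∈ , v∈″ with ∈-map⁻ (y ∷_) v∈″
    ...   | _ , _ , eq = All.lookup x∉xs y∈ (Vec.∷-injectiveˡ eq)

Counts-countList : ∀ {m n} (p : Vec (Fin m) n → Bool) → Counts (T ∘ p) (countList p (allVecs m n))
Counts-countList {m} {n} p = record
  { elements = filter p? (allVecs m n)
  ; unique = Unique.filter⁺ p? (allVecs-unique m n)
  ; sound = proj₂ ∘ ∈-filter⁻ p? {xs = allVecs m n}
  ; complete = ∈-filter⁺ p? (allVecs-complete _)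
  ; size = refl
  }
  where
  p? = λ v → T? (p v)

-- Permutations as injective words

lookup-ext : ∀ {A : Set} {n} {v w : Vec A n} → (∀ j → lookup v j ≡ lookup w j) → v ≡ w
lookup-ext h = Pointwise-≡⇒≡ (ext h)

IsPerm : ∀ {n} → Vec (Fin n) n → Set
IsPerm σ = ∀ x y → lookup σ x ≡ lookup σ y → x ≡ y

isPermᵇ⁺ : ∀ {n} (σ : Vec (Fin n) n) → IsPerm σ → T (isPermᵇ σ)
isPermᵇ⁺ σ inj = allF⁺ λ x → allF⁺ λ y → check x y
  where
  check : ∀ x y → T (not (eqFin (lookup σ x) (lookup σ y)) ∨ eqFin x y)
  check x y with lookup σ x Fin.≟ lookup σ y
  ... | yes eq = fromWitness (inj x y eq)
  ... | no _ = tt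

isPermᵇ⁻ : ∀ {n} (σ : Vec (Fin n) n) → T (isPermᵇ σ) → IsPerm σ
isPermᵇ⁻ σ perm x y eq with allF⁻ (allF⁻ perm x) y
... | check rewrite eq | eqFin-refl (lookup σ y) = toWitness check

Counts-perms : ∀ n → Counts (IsPerm {n}) (length (perms n))
Counts-perms n = record
  { elements = perms n
  ; unique = unique all
  ; sound = λ {σ} σ∈ → isPermᵇ⁻ σ (sound all σ∈)
  ; complete = λ {σ} inj → complete all (isPermᵇ⁺ σ inj)
  ; size = refl
  }
  where
  all = Counts-countList isPermᵇ

-- An injective word of length `n+1` is a first value `x` followed by an injective word in the other
-- `n` values, renumbered by `punchIn x`.
perms-length : ∀ n → length (perms n) ≡ n !
perms-length zero = refl
perms-length (suc n) = begin
  length (perms (suc n))    ≡⟨ Counts-bijection prepend prepend-perm prepend-injective prepend-surjective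
                                 (Counts-× Counts-Fin (Counts-perms n)) (Counts-perms (suc n)) ⟨
  suc n * length (perms n)  ≡⟨ cong (suc n *_) (perms-length n) ⟩
  suc n * n !               ∎
  where
  open ≡-Reasoning
  Counts-Fin : Counts {Fin (suc n)} (λ _ → ⊤) (suc n)
  Counts-Fin = record
    { elements = allFin (suc n) ; unique = Unique.allFin⁺ (suc n)
    ; sound = λ _ → tt ; complete = λ _ → ∈-allFin _ ; size = List.length-tabulate id }
  prepend : Fin (suc n) × Vec (Fin n) n → Vec (Fin (suc n)) (suc n)
  prepend (x , σ) = x ∷ Vec.map (punchIn x) σ
  prepend-perm : ∀ {xσ} → ⊤ × IsPerm (proj₂ xσ) → IsPerm (prepend xσ)
  prepend-perm (_ , inj) zero zero _ = refl
  prepend-perm {x , σ} (_ , inj) zero (suc j) eq =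
    contradiction (sym (trans eq (Vec.lookup-map j (punchIn x) σ))) (Fin.punchInᵢ≢i x _)
  prepend-perm {x , σ} (_ , inj) (suc i) zero eq =
    contradiction (trans (sym (Vec.lookup-map i (punchIn x) σ)) eq) (Fin.punchInᵢ≢i x _)
  prepend-perm {x , σ} (_ , inj) (suc i) (suc j) eq = cong suc (inj i j (Fin.punchIn-injective x _ _
    (trans (sym (Vec.lookup-map i (punchIn x) σ)) (trans eq (Vec.lookup-map j (punchIn x) σ)))))
  prepend-injective : ∀ {xσ yρ} → ⊤ × IsPerm (proj₂ xσ) → ⊤ × IsPerm (proj₂ yρ) →
    prepend xσ ≡ prepend yρ → xσ ≡ yρ
  prepend-injective {x , σ} {y , ρ} _ _ eq with Vec.∷-injective eq
  ... | refl , maps = cong (x ,_) (lookup-ext λ j → Fin.punchIn-injective x _ _ (begin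
    punchIn x (lookup σ j)                ≡⟨ Vec.lookup-map j (punchIn x) σ ⟨
    lookup (Vec.map (punchIn x) σ) j      ≡⟨ cong (λ v → lookup v j) maps ⟩
    lookup (Vec.map (punchIn x) ρ) j      ≡⟨ Vec.lookup-map j (punchIn x) ρ ⟩
    punchIn x (lookup ρ j)                ∎))
  prepend-surjective : ∀ {σ} → IsPerm σ → ∃ λ xρ → (⊤ × IsPerm (proj₂ xρ)) × prepend xρ ≡ σ
  prepend-surjective {x ∷ σ} inj = (x , ρ) , (tt , ρ-perm) , cong (x ∷_) (lookup-ext recover)
    where
    x≢ : ∀ j → x ≢ lookup σ j
    x≢ j eq = contradiction (inj zero (suc j) eq) λ ()
    ρ = Vec.tabulate λ j → punchOut (x≢ j)
    ρ-perm : IsPerm ρ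
    ρ-perm i j eq = Fin.suc-injective (inj (suc i) (suc j) (Fin.punchOut-injective (x≢ i) (x≢ j)
      (trans (sym (Vec.lookup∘tabulate _ i)) (trans eq (Vec.lookup∘tabulate _ j)))))
    recover : ∀ j → lookup (Vec.map (punchIn x) ρ) j ≡ lookup σ j
    recover j = begin
      lookup (Vec.map (punchIn x) ρ) j ≡⟨ Vec.lookup-map j (punchIn x) ρ ⟩
      punchIn x (lookup ρ j)           ≡⟨ cong (punchIn x) (Vec.lookup∘tabulate _ j) ⟩
      punchIn x (punchOut (x≢ j))      ≡⟨ Fin.punchIn-punchOut (x≢ j) ⟩
      lookup σ j                       ∎

-- If `y` were missed, deleting `y` from the codomain would inject a finite set into one with one
-- element fewer.
injective⇒surjective : ∀ {n} (f : Fin n → Fin n) → (∀ {x y} → f x ≡ f y → x ≡ y) → ∀ y → ∃ λ x → f x ≡ y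
injective⇒surjective {suc n} f inj y with Fin.any? (λ x → f x Fin.≟ y)
... | yes found = found
... | no missed = contradiction (Fin.injective⇒≤ {f = λ x → punchOut (avoid x)} λ eq →
    inj (Fin.punchOut-injective (avoid _) (avoid _) eq)) ℕ.1+n≰n
  where
  avoid : ∀ x → y ≢ f x
  avoid x eq = missed (x , sym eq)

toPermutation : ∀ {n} (σ : Vec (Fin n) n) → IsPerm σ → Permutation′ n
toPermutation σ inj = permutation (lookup σ) (proj₁ ∘ pre) (proj₂ ∘ pre) (λ x → inj _ _ (proj₂ (pre (lookup σ x))))
  where
  pre = injective⇒surjective (lookup σ) (inj _ _)

countᵇ-permute : ∀ {A : Set} {n} (p : A → Bool) (π : Permutation′ n) (v w : Vec A n) →
  (∀ j → lookup v (π ⟨$⟩ʳ j) ≡ lookup w j) → Vec.countᵇ p v ≡ Vec.countᵇ p w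
countᵇ-permute p π v w v∘π≗w = begin
  Vec.countᵇ p v                             ≡⟨ countᵇ-sum v ⟩
  sum (indicator ∘ lookup v)                 ≡⟨ sum-permute (indicator ∘ lookup v) π ⟩
  sum (λ j → indicator (lookup v (π ⟨$⟩ʳ j))) ≡⟨ sum-cong-≗ (λ j → cong indicator (v∘π≗w j)) ⟩
  sum (indicator ∘ lookup w)                 ≡⟨ countᵇ-sum w ⟨
  Vec.countᵇ p w                             ∎
  where
  open ≡-Reasoning
  indicator = λ a → if p a then 1 else 0
  countᵇ-sum : ∀ {n} (v : Vec _ n) → Vec.countᵇ p v ≡ sum (indicator ∘ lookup v)
  countᵇ-sum [] = refl
  countᵇ-sum (x ∷ v) with p x
  ... | true = cong suc (countᵇ-sum v)
  ... | false = countᵇ-sum v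

-- Pigeonhole: the `i+1` positions up to `i` cannot all be sent to the `i` positions below `i`. This
-- serves to compare two sorted rearrangements entry by entry.
permutation-moves-up : ∀ {n} (π : Permutation′ n) i →
  ∃ λ j → toℕ j ≤ toℕ i × toℕ i ≤ toℕ (π ⟨$⟩ʳ j)
permutation-moves-up π i with Fin.any? (λ j → (toℕ j ℕ.≤? toℕ i) ×-dec (toℕ i ℕ.≤? toℕ (π ⟨$⟩ʳ j)))
... | yes found = found
... | no none = contradiction (Fin.injective⇒≤ {f = λ j → Fin.fromℕ< (below j)} λ eq →
    Fin.inject≤-injective i<n i<n _ _ (Injection.injective (↔⇒↣ π) (Fin.toℕ-injective
      (Fin.fromℕ<-injective _ _ (below _) (below _) eq)))) ℕ.1+n≰n
  where
  i<n = Fin.toℕ<n i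
  below : ∀ (j : Fin (suc (toℕ i))) → toℕ (π ⟨$⟩ʳ Fin.inject≤ j i<n) < toℕ i
  below j = ℕ.≰⇒> λ up → none (Fin.inject≤ j i<n ,
    subst (_≤ toℕ i) (sym (Fin.toℕ-inject≤ j i<n)) (ℕ.s≤s⁻¹ (Fin.toℕ<n j)) , up)

-- Sorting permutations

module Sorting {A : Set} (_≼_ : A → A → Set)
  (≼-trans : ∀ {x y z} → x ≼ y → y ≼ z → x ≼ z)
  (≼-antisym : ∀ {x y} → x ≼ y → y ≼ x → x ≡ y)
  (≼-total : ∀ x y → x ≼ y ⊎ y ≼ x) where

  ≼-refl : ∀ x → x ≼ x
  ≼-refl x = [ id , id ] (≼-total x x)

  Sorted : ∀ {n} → Vec A n → Set
  Sorted = Linked _≼_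

  position : ∀ {n} → A → Vec A n → Fin (suc n)
  position x [] = zero
  position x (y ∷ s) with ≼-total x y
  ... | inj₁ _ = zero
  ... | inj₂ _ = suc (position x s)

  insertAt-sorted : ∀ {n} x {s : Vec A n} → Sorted s → Sorted (Vec.insertAt s (position x s) x)
  -- Carries the preceding letter `y` along, since `x` may land directly after it and the link
  -- `y ≼ x` is then required.
  insertAt-sorted-∷ : ∀ {n} {x y} {s : Vec A n} → y ≼ x → Sorted (y ∷ s) →
    Sorted (y ∷ Vec.insertAt s (position x s) x)
  insertAt-sorted x [] = [-]
  insertAt-sorted x {y ∷ s} sorted with ≼-total x y
  ... | inj₁ x≼y = x≼y ∷ sorted
  ... | inj₂ y≼x = insertAt-sorted-∷ y≼x sorted
  insertAt-sorted-∷ y≼x [-] = y≼x ∷ [-]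
  insertAt-sorted-∷ {x = x} {s = z ∷ s} y≼x (y≼z ∷ sorted) with ≼-total x z
  ... | inj₁ x≼z = y≼x ∷ x≼z ∷ sorted
  ... | inj₂ z≼x = y≼z ∷ insertAt-sorted-∷ z≼x sorted

  record Sort {n} (w : Vec A n) : Set where
    field
      word     : Vec A n
      sorted   : Sorted word
      π        : Permutation′ n
      word∘π≗w : ∀ j → lookup word (π ⟨$⟩ʳ j) ≡ lookup w j

  open Sort

  -- The sorting permutation is a function of `w` alone, also when letters repeat; this fixed choice
  -- makes the correspondence with stabilisers injective.
  sort : ∀ {n} (w : Vec A n) → Sort w
  sort [] = record { word = [] ; sorted = [] ; π = Perm.id ; word∘π≗w = λ () }
  sort (x ∷ w) = record
    { word = Vec.insertAt (word r) p x
    ; sorted = insertAt-sorted x (sorted r)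
    ; π = Perm.insert zero p (π r)
    ; word∘π≗w = λ where
        zero → Vec.insertAt-lookup (word r) p x
        (suc j) → trans (cong (lookup (Vec.insertAt (word r) p x)) (Perm.insert-punchIn zero p (π r) j))
                        (trans (Vec.insertAt-punchIn (word r) p x (π r ⟨$⟩ʳ j)) (word∘π≗w r j))
    }
    where
    r = sort w
    p = position x (word r)

  Sorted-monotone : ∀ {n} {s : Vec A n} → Sorted s → ∀ i j → toℕ i ≤ toℕ j → lookup s i ≼ lookup s j
  Sorted-monotone {s = s} sorted i j i≤j with ℕ.m≤n⇒m<n∨m≡n i≤j
  ... | inj₁ i<j = Linked.lookup⁺ ≼-trans sorted i<j
  ... | inj₂ i≡j rewrite Fin.toℕ-injective i≡j = ≼-refl _

  -- Choose `j ≤ i ≤ π j`. Then the entry of `s` at `i` is at most its entry at `π j`, which equals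
  -- the entry of `s′` at `j`, and that is at most the entry of `s′` at `i`.
  Sorted-rearrange-≼ : ∀ {n} {s s′ : Vec A n} → Sorted s → Sorted s′ → (π : Permutation′ n) →
    (∀ j → lookup s (π ⟨$⟩ʳ j) ≡ lookup s′ j) → ∀ i → lookup s i ≼ lookup s′ i
  Sorted-rearrange-≼ {s = s} {s′} sorted sorted′ π eq i with permutation-moves-up π i
  ... | j , j≤i , i≤πj = ≼-trans (Sorted-monotone sorted i (π ⟨$⟩ʳ j) i≤πj)
          (subst (_≼ lookup s′ i) (sym (eq j)) (Sorted-monotone sorted′ j i j≤i))

  Sorted-rearrange-≡ : ∀ {n} {s s′ : Vec A n} → Sorted s → Sorted s′ → (π : Permutation′ n) →
    (∀ j → lookup s (π ⟨$⟩ʳ j) ≡ lookup s′ j) → s ≡ s′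
  Sorted-rearrange-≡ {s = s} {s′} sorted sorted′ π eq = lookup-ext λ i → ≼-antisym
    (Sorted-rearrange-≼ sorted sorted′ π eq i)
    (Sorted-rearrange-≼ sorted′ sorted (Perm.flip π)
      (λ j → trans (sym (eq _)) (cong (lookup s) (Perm.inverseʳ π))) i)

  permute : ∀ {n} → Vec A n → Vec (Fin n) n → Vec A n
  permute s ρ = Vec.map (lookup s) ρ

  -- Both words are sorted rearrangements of `permute s ρ`, and such a rearrangement is unique.
  sort-permute : ∀ {n} {s : Vec A n} → Sorted s → (ρ : Vec (Fin n) n) → IsPerm ρ →
    word (sort (permute s ρ)) ≡ s
  sort-permute {s = s} s! ρ inj = sym (Sorted-rearrange-≡ s! (sorted r)
    -- The composite acts from left to right: first the inverse of the sorting permutation, then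
    -- `ρ`.
    (Perm.flip (π r) Perm.∘ₚ toPermutation ρ inj) λ j → begin
      lookup s (lookup ρ (π r ⟨$⟩ˡ j))         ≡⟨ Vec.lookup-map _ (lookup s) ρ ⟨
      lookup (permute s ρ) (π r ⟨$⟩ˡ j)        ≡⟨ word∘π≗w r _ ⟨
      lookup (word r) (π r ⟨$⟩ʳ (π r ⟨$⟩ˡ j))  ≡⟨ cong (lookup (word r)) (Perm.inverseʳ (π r)) ⟩
      lookup (word r) j                        ∎)
    where
    open ≡-Reasoning
    r = sort (permute s ρ)

  -- Sends (ρ , s) to (τ⁻¹ρ , w) for w = s ∘ ρ and τ the permutation sorting w;
  -- τ⁻¹ρ stabilises w because s ∘ τ = w = s ∘ ρ.
  toStabiliser : ∀ {n} → Vec (Fin n) n → Vec A n → Vec (Fin n) n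
  toStabiliser ρ s = Vec.map (π (sort (permute s ρ)) ⟨$⟩ˡ_) ρ

  Fixes : ∀ {n} → Vec (Fin n) n → Vec A n → Set
  Fixes σ w = ∀ j → lookup w (lookup σ j) ≡ lookup w j

  toStabiliser-perm : ∀ {n} (ρ : Vec (Fin n) n) (s : Vec A n) → IsPerm ρ → IsPerm (toStabiliser ρ s)
  toStabiliser-perm ρ s inj x y eq = inj x y (Injection.injective (↔⇒↣ (Perm.flip (π r)))
    (trans (sym (Vec.lookup-map x _ ρ)) (trans eq (Vec.lookup-map y _ ρ))))
    where
    r = sort (permute s ρ)

  toStabiliser-fixes : ∀ {n} (ρ : Vec (Fin n) n) {s : Vec A n} → IsPerm ρ → Sorted s →
    Fixes (toStabiliser ρ s) (permute s ρ)
  toStabiliser-fixes ρ {s} inj s! j = begin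
    lookup w (lookup (toStabiliser ρ s) j)        ≡⟨ cong (lookup w) (Vec.lookup-map j _ ρ) ⟩
    lookup w (π r ⟨$⟩ˡ lookup ρ j)                ≡⟨ word∘π≗w r _ ⟨
    lookup (word r) (π r ⟨$⟩ʳ (π r ⟨$⟩ˡ lookup ρ j)) ≡⟨ cong₂ lookup (sort-permute s! ρ inj) (Perm.inverseʳ (π r)) ⟩
    lookup s (lookup ρ j)                         ≡⟨ Vec.lookup-map j (lookup s) ρ ⟨
    lookup w j                                    ∎
    where
    open ≡-Reasoning
    w = permute s ρ
    r = sort w

  -- The common word `w` determines its sorting permutation τ and its sorted form `s`. Cancelling
  -- τ⁻¹ from τ⁻¹ρ = τ⁻¹ρ′ then gives ρ = ρ′.
  toStabiliser-injective : ∀ {n} (ρ ρ′ : Vec (Fin n) n) {s s′ : Vec A n} →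
    IsPerm ρ → IsPerm ρ′ → Sorted s → Sorted s′ →
    toStabiliser ρ s ≡ toStabiliser ρ′ s′ → permute s ρ ≡ permute s′ ρ′ → ρ ≡ ρ′ × s ≡ s′
  toStabiliser-injective ρ ρ′ {s} {s′} inj inj′ s! s′! σ≡σ′ w≡w′ =
    lookup-ext (λ j → Injection.injective (↔⇒↣ (Perm.flip τ)) (begin
      τ ⟨$⟩ˡ lookup ρ j             ≡⟨ Vec.lookup-map j _ ρ ⟨
      lookup (toStabiliser ρ s) j   ≡⟨ cong (λ σ → lookup σ j) σ≡σ′ ⟩
      lookup (toStabiliser ρ′ s′) j ≡⟨ cong (λ w → lookup (Vec.map (π (sort w) ⟨$⟩ˡ_) ρ′) j) w≡w′ ⟨
      lookup (Vec.map (τ ⟨$⟩ˡ_) ρ′) j ≡⟨ Vec.lookup-map j _ ρ′ ⟩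
      τ ⟨$⟩ˡ lookup ρ′ j            ∎)) ,
    trans (sym (sort-permute s! ρ inj)) (trans (cong (λ w → word (sort w)) w≡w′) (sort-permute s′! ρ′ inj′))
    where
    open ≡-Reasoning
    τ = π (sort (permute s ρ))

  -- The preimage is ρ = τσ together with the sorted form `s` of `w`: as `s ∘ τ = w` and σ fixes
  -- `w`, also `s ∘ ρ = w`.
  toStabiliser-surjective : ∀ {n} (σ : Vec (Fin n) n) (w : Vec A n) → IsPerm σ → Fixes σ w →
    let r = sort w ; ρ = Vec.map (π r ⟨$⟩ʳ_) σ in
    IsPerm ρ × permute (word r) ρ ≡ w × toStabiliser ρ (word r) ≡ σ
  toStabiliser-surjective σ w inj fixes = ρ-perm , restore , stabiliser
    where
    open ≡-Reasoning
    r = sort w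
    ρ = Vec.map (π r ⟨$⟩ʳ_) σ
    ρ-perm : IsPerm ρ
    ρ-perm x y eq = inj x y (Injection.injective (↔⇒↣ (π r))
      (trans (sym (Vec.lookup-map x _ σ)) (trans eq (Vec.lookup-map y _ σ))))
    restore : permute (word r) ρ ≡ w
    restore = lookup-ext λ j → begin
      lookup (permute (word r) ρ) j        ≡⟨ Vec.lookup-map j _ ρ ⟩
      lookup (word r) (lookup ρ j)         ≡⟨ cong (lookup (word r)) (Vec.lookup-map j _ σ) ⟩
      lookup (word r) (π r ⟨$⟩ʳ lookup σ j) ≡⟨ word∘π≗w r (lookup σ j) ⟩
      lookup w (lookup σ j)                ≡⟨ fixes j ⟩
      lookup w j                           ∎
    stabiliser : toStabiliser ρ (word r) ≡ σ
    stabiliser = lookup-ext λ j → begin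
      -- By `restore` the word being sorted is again `w`, so the same τ appears and cancels.
      lookup (toStabiliser ρ (word r)) j     ≡⟨ cong (λ w → lookup (Vec.map (π (sort w) ⟨$⟩ˡ_) ρ) j) restore ⟩
      lookup (Vec.map (π r ⟨$⟩ˡ_) ρ) j       ≡⟨ Vec.lookup-map j _ ρ ⟩
      π r ⟨$⟩ˡ lookup ρ j                    ≡⟨ cong (π r ⟨$⟩ˡ_) (Vec.lookup-map j _ σ) ⟩
      π r ⟨$⟩ˡ (π r ⟨$⟩ʳ lookup σ j)         ≡⟨ Perm.inverseˡ (π r) ⟩
      lookup σ j                             ∎

-- Tabloid and invariance tests under permutation of letters

isTabloidᵇ⁺ : ∀ {ℓ n} (shape : Vec ℕ ℓ) (v : Filling ℓ n) → IsTabloid shape v → T (isTabloidᵇ shape v)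
isTabloidᵇ⁺ shape v tab = allF⁺ λ r → fromWitness (tab r)

isTabloidᵇ⁻ : ∀ {ℓ n} (shape : Vec ℕ ℓ) (v : Filling ℓ n) → T (isTabloidᵇ shape v) → IsTabloid shape v
isTabloidᵇ⁻ shape v tab r = toWitness (allF⁻ tab r)

IsTabloid-permute : ∀ {ℓ n} (shape : Vec ℕ ℓ) (π : Permutation′ n) (v w : Filling ℓ n) →
  (∀ j → lookup v (π ⟨$⟩ʳ j) ≡ lookup w j) → IsTabloid shape v → IsTabloid shape w
IsTabloid-permute shape π v w eq tab r = trans (sym (countᵇ-permute (eqFin r) π v w eq)) (tab r)

IsTabloid-unpermute : ∀ {ℓ n} (shape : Vec ℕ ℓ) (π : Permutation′ n) (v w : Filling ℓ n) →
  (∀ j → lookup v (π ⟨$⟩ʳ j) ≡ lookup w j) → IsTabloid shape w → IsTabloid shape v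
IsTabloid-unpermute shape π v w eq tab r = trans (countᵇ-permute (eqFin r) π v w eq) (tab r)

σInvariant⁺ : ∀ {m n} (σ : Vec (Fin n) n) (u : Vec (Fin m) n) →
  (∀ j → lookup u (lookup σ j) ≡ lookup u j) → T (σInvariant σ u)
σInvariant⁺ σ u fixes = allF⁺ λ j → fromWitness (fixes j)

σInvariant⁻ : ∀ {m n} (σ : Vec (Fin n) n) (u : Vec (Fin m) n) →
  T (σInvariant σ u) → ∀ j → lookup u (lookup σ j) ≡ lookup u j
σInvariant⁻ σ u inv j = toWitness (allF⁻ inv j)

-- Biwords: columns (row of a letter, variable), sorted by increasing variable and then
-- decreasing row.  Columnwise, this is the condition defining F_I for I the set of ascents.

_≼_ : ∀ {ℓ N} → Fin ℓ × Fin N → Fin ℓ × Fin N → Set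
(r , x) ≼ (s , y) = toℕ x < toℕ y ⊎ (x ≡ y × toℕ s ≤ toℕ r)

≼-trans : ∀ {ℓ N} {p q r : Fin ℓ × Fin N} → p ≼ q → q ≼ r → p ≼ r
≼-trans (inj₁ x<y) (inj₁ y<z) = inj₁ (ℕ.<-trans x<y y<z)
≼-trans (inj₁ x<y) (inj₂ (refl , _)) = inj₁ x<y
≼-trans (inj₂ (refl , _)) (inj₁ y<z) = inj₁ y<z
≼-trans (inj₂ (refl , s≤r)) (inj₂ (refl , t≤s)) = inj₂ (refl , ℕ.≤-trans t≤s s≤r)

≼-antisym : ∀ {ℓ N} {p q : Fin ℓ × Fin N} → p ≼ q → q ≼ p → p ≡ q
≼-antisym (inj₁ x<y) (inj₁ y<x) = contradiction y<x (ℕ.<-asym x<y)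
≼-antisym (inj₁ x<y) (inj₂ (refl , _)) = contradiction x<y (ℕ.<-irrefl refl)
≼-antisym (inj₂ (refl , _)) (inj₁ y<x) = contradiction y<x (ℕ.<-irrefl refl)
≼-antisym (inj₂ (refl , s≤r)) (inj₂ (_ , r≤s)) = cong (_, _) (Fin.toℕ-injective (ℕ.≤-antisym r≤s s≤r))

≼-total : ∀ {ℓ N} (p q : Fin ℓ × Fin N) → p ≼ q ⊎ q ≼ p
≼-total (r , x) (s , y) with Fin.<-cmp x y
... | tri< x<y _ _ = inj₁ (inj₁ x<y)
... | tri> _ _ y<x = inj₂ (inj₁ y<x)
... | tri≈ _ refl _ with ℕ.≤-total (toℕ r) (toℕ s)
...   | inj₁ r≤s = inj₂ (inj₂ (refl , r≤s))
...   | inj₂ s≤r = inj₁ (inj₂ (refl , s≤r))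

module _ {ℓ N} (r s : Fin ℓ) (x y : Fin N) where

  -- The test of `fundCond` on neighbouring variables `x`, `y`, with membership in `I` replaced by
  -- the ascent `r < s` of the rows above them.
  fundStep : Bool
  fundStep = if ltFin r s then ltFin x y else ⌊ toℕ x ℕ.≤? toℕ y ⌋

  fundStep⇒≼ : T fundStep → (r , x) ≼ (s , y)
  fundStep⇒≼ with toℕ r ℕ.<? toℕ s
  ... | yes _ = inj₁ ∘ toWitness
  ... | no r≮s = λ x≤y → map₂ (λ x≡y → Fin.toℕ-injective x≡y , ℕ.≮⇒≥ r≮s) (ℕ.m≤n⇒m<n∨m≡n (toWitness x≤y))

  ≼⇒fundStep : (r , x) ≼ (s , y) → T fundStep
  ≼⇒fundStep x≼y with toℕ r ℕ.<? toℕ s | x≼y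
  ... | yes _   | inj₁ x<y = fromWitness x<y
  ... | yes r<s | inj₂ (_ , s≤r) = contradiction r<s (ℕ.≤⇒≯ s≤r)
  ... | no _    | inj₁ x<y = fromWitness (ℕ.<⇒≤ x<y)
  ... | no _    | inj₂ (refl , _) = fromWitness ℕ.≤-refl

-- The offset `p` counts the letters already consumed: `fundCond` keeps `I` and advances its index,
-- whereas `ascent` restarts at 0 on the remaining word.
fundCond⇔Linked : ∀ {ℓ N n} (I : ℕ → Bool) p (v : Filling ℓ n) (u : Vec (Fin N) n) →
  (∀ i → I (i + p) ≡ ascent i v) → T (fundCond I p u) ⇔ Linked _≼_ (Vec.zip v u)
fundCond⇔Linked I p [] [] _ = mk⇔ (λ _ → []) _
fundCond⇔Linked I p (r ∷ []) (x ∷ []) _ = mk⇔ (λ _ → [-]) _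
fundCond⇔Linked I p (r ∷ s ∷ v) (x ∷ y ∷ u) I≡ascent =
  let ih = fundCond⇔Linked I (suc p) (s ∷ v) (y ∷ u) λ i → trans (cong I (ℕ.+-suc i p)) (I≡ascent (suc i))
  in subst
  (λ b → T ((if b then ltFin x y else ⌊ toℕ x ℕ.≤? toℕ y ⌋) ∧ fundCond I (suc p) (y ∷ u)) ⇔
         Linked _≼_ (Vec.zip (r ∷ s ∷ v) (x ∷ y ∷ u)))
  -- Replaces the ascent test on `r`, `s` by `I p`, so the equivalence can be proved with
  -- `fundStep`.
  (sym (I≡ascent 0))
  (mk⇔
    (λ h → let first , rest = Equivalence.to T-∧ h in
           fundStep⇒≼ r s x y first ∷ Equivalence.to ih rest)
    (λ linked → Equivalence.from T-∧
      (≼⇒fundStep r s x y (Linked.head linked) , Equivalence.from ih (Linked.tail linked))))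

-- Sorted biwords and biwords with a stabilising permutation

module Characteristic {ℓ k n} (shape : Vec ℕ ℓ) (vs : Vec (Filling ℓ n) k)
  (basis : IsOrderedTabloidBasis shape vs) (extends : ExtendsDom vs) (N : ℕ) (a : Vec ℕ N) where

  open Basis shape vs basis extends using (tabloid; index-injective; inDescent≡ascent)
  open Sorting (_≼_ {ℓ} {N}) ≼-trans ≼-antisym ≼-total
  open Sort

  -- A free permutation ρ next to a sorted biword of content `a`, whose upper word is given by its
  -- index `t` in the basis.
  Quasisymmetric : Vec (Fin n) n × (Fin k × Vec (Fin N) n) → Set
  Quasisymmetric (ρ , t , u) = IsPerm ρ × T (fundCond (inDescent vs t) 0 u ∧ hasContent a u)

  -- The two tests are those counted by `charM` and `powerCoef`. The product of these counts for one
  -- σ is the number of biwords fixed by σ with rows of the given shape and content `a`.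
  Symmetric : Vec (Fin n) n × (Filling ℓ n × Vec (Fin N) n) → Set
  Symmetric (σ , v , u) = σ ∈ perms n × T (isTabloidᵇ shape v ∧ σInvariant σ v) × T (σInvariant σ u ∧ hasContent a u)

  Counts-Quasisymmetric : Counts Quasisymmetric (length (perms n) * FQcoef n vs N a)
  Counts-Quasisymmetric = Counts-× (Counts-perms n) (Counts-sumFℕ λ t → Counts-countList _)

  Counts-Symmetric : Counts Symmetric (nFactFcharCoef n shape N a)
  Counts-Symmetric = Counts-Σ (perms n) (unique (Counts-perms n)) λ σ →
    Counts-× (Counts-countList _) (Counts-countList _)

  fundCond⇔Sorted : ∀ t u → T (fundCond (inDescent vs t) 0 u) ⇔ Sorted (Vec.zip (lookup vs t) u)
  fundCond⇔Sorted t u = fundCond⇔Linked (inDescent vs t) 0 (lookup vs t) u λ i →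
    trans (cong (inDescent vs t) (ℕ.+-identityʳ i)) (inDescent≡ascent t i)

  biword : Fin k → Vec (Fin N) n → Vec (Fin ℓ × Fin N) n
  biword t u = Vec.zip (lookup vs t) u

  stabilised : Vec (Fin n) n × (Fin k × Vec (Fin N) n) → Vec (Fin n) n × (Filling ℓ n × Vec (Fin N) n)
  stabilised (ρ , t , u) = toStabiliser ρ (biword t u) , Vec.unzip (permute (biword t u) ρ)

  lookup₁ : ∀ (w : Vec (Fin ℓ × Fin N) n) j → lookup (proj₁ (Vec.unzip w)) j ≡ proj₁ (lookup w j)
  lookup₁ w j = cong proj₁ (Vec.lookup-unzip j w)

  lookup₂ : ∀ (w : Vec (Fin ℓ × Fin N) n) j → lookup (proj₂ (Vec.unzip w)) j ≡ proj₂ (lookup w j)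
  lookup₂ w j = cong proj₂ (Vec.lookup-unzip j w)

  stabilised-symmetric : ∀ z → Quasisymmetric z → Symmetric (stabilised z)
  stabilised-symmetric (ρ , t , u) (inj , h) =
    complete (Counts-perms n) (toStabiliser-perm ρ s inj) ,
    Equivalence.from T-∧
      ( isTabloidᵇ⁺ shape v₁ (IsTabloid-permute shape π′ (lookup vs t) v₁ lookup-v (tabloid t))
      , σInvariant⁺ σ v₁ λ j → trans (lookup₁ w _) (trans (cong proj₁ (fixes j)) (sym (lookup₁ w j)))) ,
    Equivalence.from T-∧
      ( σInvariant⁺ σ u₁ (λ j → trans (lookup₂ w _) (trans (cong proj₂ (fixes j)) (sym (lookup₂ w j))))
      -- `hasContent a` unfolds to the same test as `isTabloidᵇ a`, so contents are handled by the
      -- tabloid lemmas.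
      , isTabloidᵇ⁺ a u₁ (IsTabloid-permute a π′ u u₁ lookup-u (isTabloidᵇ⁻ a u content)))
    where
    s = biword t u
    σ = toStabiliser ρ s
    w = permute s ρ
    v₁ = proj₁ (Vec.unzip w)
    u₁ = proj₂ (Vec.unzip w)
    π′ = toPermutation ρ inj
    content = proj₂ (Equivalence.to T-∧ h)
    fixes = toStabiliser-fixes ρ inj (Equivalence.to (fundCond⇔Sorted t u) (proj₁ (Equivalence.to T-∧ h)))
    lookup-w : ∀ j → lookup w j ≡ (lookup (lookup vs t) (lookup ρ j) , lookup u (lookup ρ j))
    lookup-w j = trans (Vec.lookup-map j (lookup s) ρ) (Vec.lookup-zip (lookup ρ j) (lookup vs t) u)
    lookup-v : ∀ j → lookup (lookup vs t) (lookup ρ j) ≡ lookup v₁ j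
    lookup-v j = sym (trans (lookup₁ w j) (cong proj₁ (lookup-w j)))
    lookup-u : ∀ j → lookup u (lookup ρ j) ≡ lookup u₁ j
    lookup-u j = sym (trans (lookup₂ w j) (cong proj₂ (lookup-w j)))

  unzip-injective : ∀ {w w′ : Vec (Fin ℓ × Fin N) n} → Vec.unzip w ≡ Vec.unzip w′ → w ≡ w′
  unzip-injective {w} {w′} eq =
    trans (sym (Vec.zip∘unzip w)) (trans (cong (uncurry Vec.zip) eq) (Vec.zip∘unzip w′))

  zip-injective : ∀ {v v′ : Filling ℓ n} {u u′ : Vec (Fin N) n} → Vec.zip v u ≡ Vec.zip v′ u′ → v ≡ v′ × u ≡ u′
  zip-injective {v} {v′} {u} {u′} eq =
    ,-injective (trans (sym (Vec.unzip∘zip v u)) (trans (cong Vec.unzip eq) (Vec.unzip∘zip v′ u′)))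

  stabilised-injective : ∀ z z′ → Quasisymmetric z → Quasisymmetric z′ → stabilised z ≡ stabilised z′ → z ≡ z′
  stabilised-injective (ρ , t , u) (ρ′ , t′ , u′) (inj , h) (inj′ , h′) eq
    with toStabiliser-injective ρ ρ′ inj inj′
           (Equivalence.to (fundCond⇔Sorted t u) (proj₁ (Equivalence.to T-∧ h)))
           (Equivalence.to (fundCond⇔Sorted t′ u′) (proj₁ (Equivalence.to T-∧ h′)))
           (proj₁ (,-injective eq)) (unzip-injective (proj₂ (,-injective eq)))
  ... | refl , s≡s′ with zip-injective s≡s′
  -- The basis lists each tabloid once, so the upper word determines its index.
  ...   | v≡v′ , refl with index-injective t t′ v≡v′
  ...     | refl = refl

  stabilised-surjective : ∀ y → Symmetric y → ∃ λ z → Quasisymmetric z × stabilised z ≡ y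
  stabilised-surjective (σ , v , u) (σ∈ , hv , hu) with Equivalence.to T-∧ hv | Equivalence.to T-∧ hu
  ... | v-tab , v-inv | u-inv , u-content = result
    where
    w = Vec.zip v u
    r = sort w
    v₀ = proj₁ (Vec.unzip (word r))
    u₀ = proj₂ (Vec.unzip (word r))
    fixes : Fixes σ w
    fixes j = trans (Vec.lookup-zip _ v u)
      (trans (cong₂ _,_ (σInvariant⁻ σ v v-inv j) (σInvariant⁻ σ u u-inv j)) (sym (Vec.lookup-zip j v u)))
    lookup-v : ∀ j → lookup v₀ (π r ⟨$⟩ʳ j) ≡ lookup v j
    lookup-v j = trans (lookup₁ (word r) _) (cong proj₁ (trans (word∘π≗w r j) (Vec.lookup-zip j v u)))
    lookup-u : ∀ j → lookup u₀ (π r ⟨$⟩ʳ j) ≡ lookup u j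
    lookup-u j = trans (lookup₂ (word r) _) (cong proj₂ (trans (word∘π≗w r j) (Vec.lookup-zip j v u)))
    v₀-tab : IsTabloid shape v₀
    v₀-tab = IsTabloid-unpermute shape (π r) v₀ v lookup-v (isTabloidᵇ⁻ shape v v-tab)
    u₀-content : T (hasContent a u₀)
    u₀-content = isTabloidᵇ⁺ a u₀ (IsTabloid-unpermute a (π r) u₀ u lookup-u (isTabloidᵇ⁻ a u u-content))
    ρ = Vec.map (π r ⟨$⟩ʳ_) σ
    result : ∃ λ z → Quasisymmetric z × stabilised z ≡ (σ , v , u)
    -- The upper row of the sorted biword is again a tabloid of the shape, hence occurs in the basis
    -- at some index `t`.
    result with proj₂ (proj₂ basis) v₀ v₀-tab
       | toStabiliser-surjective σ w (sound (Counts-perms n) σ∈) fixes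
    ... | t , vt≡v₀ | ρ-perm , restore , stabiliser =
      (ρ , t , u₀) ,
      (ρ-perm , Equivalence.from T-∧
        (Equivalence.from (fundCond⇔Sorted t u₀) (subst Sorted (sym biword≡word) (sorted r)) , u₀-content)) ,
      cong₂ _,_ (trans (cong (toStabiliser ρ) biword≡word) stabiliser)
        (trans (cong Vec.unzip (trans (cong (λ s → permute s ρ) biword≡word) restore)) (Vec.unzip∘zip v u))
      where
      biword≡word : biword t u₀ ≡ word r
      biword≡word = trans (cong (λ v → Vec.zip v u₀) vt≡v₀) (Vec.zip∘unzip (word r))

  characteristic : (n !) * FQcoef n vs N a ≡ nFactFcharCoef n shape N a
  -- Reading `n !` as the number of permutations makes the left side the count of pairs of a
  -- permutation and a sorted biword.
  characteristic = trans (cong (_* FQcoef n vs N a) (sym (perms-length n)))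
    (Counts-bijection stabilised (λ {z} → stabilised-symmetric z) (λ {z} {z′} → stabilised-injective z z′)
      (λ {y} → stabilised-surjective y) Counts-Quasisymmetric Counts-Symmetric)

theorem3 : ∀ {ℓ k} (n : ℕ) (shape : Vec ℕ ℓ) → IsPartition n shape →
    (vs : Vec (Filling ℓ n) k) → IsOrderedTabloidBasis shape vs → ExtendsDom vs →
    SQCC n shape vs
theorem3 n shape _ vs basis extends =
  casesCovered , heckeRelations , flagStable , Characteristic.characteristic shape vs basis extends
  where
  open Basis shape vs basis extends
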